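{- Let $p$ be a prime and let $h, r$ be integers with $h = mr + \epsilon$, where $m \geq 0$ and $0 \leq \epsilon \leq r-1$ are integers. Let $A \subseteq \mathbb{Z}/p\mathbb{Z}$ be a nonempty set with $|A| = k$ such that $1 \leq r \leq h \leq rk$. Then $$|h^{(r)} A| \geq \min\left(p,\; hk - m^2 r + 1 - 2m\epsilon - \epsilon\right).$$
   Context: For a finite set $A = \{a_1, \dots, a_k\}$ of $k$ distinct elements of an abelian group $G$ and integers $h, r \geq 1$, the generalized $h$-fold sumset is $$h^{(r)} A = \left\{ \sum_{i=1}^k r_i a_i : 0 \leq r_i \leq r \text{ for } i = 1, \dots, k \text{ and } \sum_{i=1}^k r_i = h \right\},$$ i.e. the set of sums of $h$ elements of $A$ in which each element of $A$ appears at most $r$ times. -}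

module Defs where

open import Data.Nat using (ℕ; _+_; _*_; _≤_)
open import Data.Nat.DivMod using (_%_)
open import Data.Nat.Primality using (Prime; prime⇒nonZero)
open import Data.Fin using (Fin; toℕ)
open import Data.Vec.Functional using (foldr)
open import Data.Product using (Σ; ∃; ∃-syntax; _×_)
open import Function.Definitions using (Injective)
open import Relation.Binary.PropositionalEquality using (_≡_)

ΣFin : ∀ {k} → (Fin k → ℕ) → ℕ
ΣFin c = foldr _+_ 0 c

-- ℤ/pℤ is modelled by Fin p (residues 0..p-1); the residue of a sum
-- Σ r_i a_i (a_i ∈ ℤ/pℤ) is (Σ r_i * toℕ a_i) mod p.
-- x ∈ h^(r) A, where A = {a 0, …, a (k-1)} (a injective):
-- there are multiplicities c i with 0 ≤ c i ≤ r, Σ c i = h and x = Σ c i a i.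
InSumset : (p : ℕ) → Prime p → (k : ℕ) → (Fin k → Fin p) → (h r : ℕ) → Fin p → Set
InSumset p pp k a h r x =
  ∃[ c ] ((∀ i → c i ≤ r) × (ΣFin c ≡ h) ×
    (toℕ x ≡ _%_ (ΣFin (λ i → c i * toℕ (a i))) p {{prime⇒nonZero pp}}))

-- |{x : P x}| ≥ n : there are n distinct elements of ℤ/pℤ satisfying P.
HasAtLeast : (p : ℕ) → (Fin p → Set) → ℕ → Set
HasAtLeast p P n = ∃[ f ] (Injective _≡_ _≡_ f × (∀ (i : Fin n) → P (f i)))

{-# OPTIONS --safe #-}

-- Write h = ε (m + 1) + (r - ε) m. The sumset contains every sum of r blocks, ε of them
-- consisting of m + 1 distinct elements of A and r - ε of them of m distinct elements.
-- As long as the known sums t are fewer than the bound, evaluate the polynomial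
-- ∏ₜ (Σ x - t) · ∏ V(block), with V the Vandermonde product, by a tensor product of divided
-- differences at prefixes of A. Multiplying the argument by x turns the divided difference of
-- order n, scaled by n!, into a diagonal term plus n times the one of order n - 1, so the identity
-- Σᵢ cᵢ V(c - eᵢ) = (Σ c - n(n-1)/2) V(c), for c of length n, gives for orders c of the right
-- total degree the value (number of t)! · ∏ V(c). It is nonzero mod p, so the polynomial is
-- nonzero at some point of the grid: there every block has distinct entries and the total sum
-- is a new one.
module Submission where

open import Defs
import Data.Nat as ℕ
import Data.Nat.Properties as ℕP
import Data.Integer.Properties as ℤP

-- Polynomials are met only through their values: each functional is a finite weighted sum of point
-- evaluations, so a nonzero result hands over a grid point at once, without any formal coefficients
-- or degrees. A functional of order `n` uses the nodes `0, …, n`, so all orders must stay below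
-- `k`; since `k ≤ p`, distinct orders within a block make `V(c)` prime to `p`. The scaling by
-- factorials removes denominators: the plain coefficient of `x^c` in `(Σ x)^s V(x)` is
-- `s! V(c) / ∏ cᵢ!`, and the multinomial factors that share `s` among several blocks cancel in the
-- same way. Hence every admissible choice of orders works, and `s` is limited only by `s < p` and
-- by the room for raising orders above the staircase, which is `n(k - n)` for a block of size `n`.
-- Nearly equal sizes minimise the sum of their squares and so maximise the total room. The last 1
-- in the bound is the sum still gained when `s` equals the whole room.

module PolynomialMethod where
  open import Agda.Builtin.Int using (pos)
  open import Data.Fin using (Fin; zero; suc; toℕ; fromℕ<)
  import Data.Fin.Properties as FinP
  open import Data.Integer using (ℤ; +_; -[1+_]; _+_; _*_; _-_; -_; ∣_∣)
  open import Data.Integer.Divisibility.Signed using (_∣_; divides; _∣?_; ∣m∣n⇒∣m+n; ∣n⇒∣m*n; ∣⇒∣ᵤ; ∣ᵤ⇒∣)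
  open import Data.Integer.Tactic.RingSolver using (solve-∀)
  open import Data.List using (List; []; _∷_; map; length; _++_; replicate; tabulate)
  open import Data.List.Membership.Propositional using (_∈_)
  open import Data.List.Membership.Propositional.Properties using (∈-tabulate⁺)
  open import Data.List.Properties using (length-map; length-++; length-replicate; length-tabulate; map-++; map-id)
  open import Data.List.Relation.Binary.Permutation.Propositional as ↭ using (_↭_)
  open import Data.List.Relation.Unary.All as All using (All; []; _∷_)
  import Data.List.Relation.Unary.All.Properties as AllP
  open import Data.List.Relation.Unary.Any using (Any; here; there)
  open import Data.Nat using (ℕ; zero; suc; _!; _<_; _≤_; s≤s; z≤n; _∸_; _⊓_)
  open import Data.Nat.Coprimality using (Coprime; coprime-Bézout)
  import Data.Nat.Divisibility as ℕD
  open import Data.Nat.DivMod using (_%_; _/_; _mod_; m%n<n; m<n⇒m%n≡m; m≡m%n+[m/n]*n)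
  open import Data.Nat.GCD using (module Bézout)
  open import Data.Nat.ListAction using (sum)
  open import Data.Nat.ListAction.Properties using (sum-++)
  open import Data.Nat.Primality using (Prime; euclidsLemma; prime⇒irreducible; prime⇒nonZero; ¬prime[1])
  import Data.Nat.Tactic.RingSolver as ℕSolver
  open import Data.Product using (_×_; _,_; proj₁; proj₂; map₂; ∃-syntax)
  open import Data.Sum as Sum using (_⊎_; inj₁; inj₂; [_,_]′)
  open import Data.Unit using (tt)
  open import Function using (_∘_; id)
  open import Function.Definitions using (Injective)
  open import Relation.Binary.Bundles using (Setoid)
  open import Relation.Binary.PropositionalEquality
  import Relation.Binary.Reasoning.Setoid as SetoidReasoning
  open import Relation.Nullary using (¬_; Dec; yes; no; contradiction)
  open import Relation.Nullary.Decidable using (map′)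

  -- Vandermonde products with one argument lowered

  -- Both the degree of the Vandermonde product in `n` variables and the least sum of `n` distinct
  -- naturals.
  triangle : ℕ → ℕ
  triangle zero    = 0
  triangle (suc n) = n ℕ.+ triangle n

  sumℤ : List ℤ → ℤ
  sumℤ []       = + 0
  sumℤ (d ∷ ds) = d + sumℤ ds

  ∏- : ℤ → List ℤ → ℤ
  ∏- x []       = + 1
  ∏- x (d ∷ ds) = (x - d) * ∏- x ds

  vandermonde : List ℤ → ℤ
  vandermonde []       = + 1
  vandermonde (d ∷ ds) = ∏- d ds * vandermonde ds

  -- Σᵢ f dᵢ (d without dᵢ) (d with dᵢ lowered by one).
  Σ-lower : (ℤ → List ℤ → List ℤ → ℤ) → List ℤ → ℤ
  Σ-lower f []       = + 0
  Σ-lower f (d ∷ ds) = f d ds (d - + 1 ∷ ds) + Σ-lower (λ e o l → f e (d ∷ o) (d ∷ l)) ds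

  -- Positions are never tracked: the effect of removing or lowering an entry is recorded only
  -- through the products `∏-`, which is all that the identities below inspect.
  IsLowering : List ℤ → ℤ → List ℤ → List ℤ → Set
  IsLowering ds e o l = (∀ x → ∏- x ds ≡ (x - e) * ∏- x o) × (∀ x → ∏- x l ≡ (x - e + + 1) * ∏- x o)

  Σ-lower-cong : ∀ {f g} ds → (∀ e o l → IsLowering ds e o l → f e o l ≡ g e o l) → Σ-lower f ds ≡ Σ-lower g ds
  Σ-lower-cong []       eq = refl
  Σ-lower-cong (d ∷ ds) eq = cong₂ _+_
    (eq d ds _ ((λ x → refl) , λ x → cong (_* ∏- x ds) (shift x d)))
    (Σ-lower-cong ds λ e o l (whole , lowered) → eq e (d ∷ o) (d ∷ l)
      ( (λ x → trans (cong ((x - d) *_) (whole x)) (exchange (x - d) (x - e) (∏- x o)))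
      , (λ x → trans (cong ((x - d) *_) (lowered x)) (exchange (x - d) (x - e + + 1) (∏- x o)))))
    where
    shift : ∀ x d → x - (d - + 1) ≡ x - d + + 1
    shift = solve-∀
    exchange : ∀ u v w → u * (v * w) ≡ v * (u * w)
    exchange = solve-∀

  Σ-lower-linear : ∀ s t f g ds →
    Σ-lower (λ e o l → s * f e o l + t * g e o l) ds ≡ s * Σ-lower f ds + t * Σ-lower g ds
  Σ-lower-linear s t f g []       = zeros s t
    where
    zeros : ∀ s t → + 0 ≡ s * + 0 + t * + 0
    zeros = solve-∀
  Σ-lower-linear s t f g (d ∷ ds)
    rewrite Σ-lower-linear s t (λ e o l → f e (d ∷ o) (d ∷ l)) (λ e o l → g e (d ∷ o) (d ∷ l)) ds
    = regroup s t _ _ _ _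
    where
    regroup : ∀ s t a b c d → (s * a + t * b) + (s * c + t * d) ≡ s * (a + c) + t * (b + d)
    regroup = solve-∀

  -- Lagrange interpolation in x, with the denominators cleared.
  Σ-cofactor : ∀ x ds →
    Σ-lower (λ e o l → ∏- x o * vandermonde l) ds ≡ (∏- x ds - ∏- (x - + 1) ds) * vandermonde ds
  Σ-cofactor x []       = refl
  Σ-cofactor x (d ∷ ds) = begin
    ∏- x ds * (∏- (d - + 1) ds * V) + Σ-lower (λ e o l → (x - d) * ∏- x o * (∏- d l * vandermonde l)) ds
      ≡⟨ cong (λ u → head + u) (Σ-lower-cong ds λ e o l (whole , lowered) → tail-term e o l (whole d) (whole x) (lowered d)) ⟩
    head + Σ-lower (λ e o l → ((x - d - + 1) * ∏- d ds) * (∏- x o * vandermonde l) + ∏- x ds * (∏- d o * vandermonde l)) ds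
      ≡⟨ cong (λ u → head + u) (Σ-lower-linear ((x - d - + 1) * ∏- d ds) (∏- x ds)
          (λ e o l → ∏- x o * vandermonde l) (λ e o l → ∏- d o * vandermonde l) ds) ⟩
    head + (((x - d - + 1) * ∏- d ds) * Σ-lower (λ e o l → ∏- x o * vandermonde l) ds
              + ∏- x ds * Σ-lower (λ e o l → ∏- d o * vandermonde l) ds)
      ≡⟨ cong₂ (λ u v → head + (((x - d - + 1) * ∏- d ds) * u + ∏- x ds * v)) (Σ-cofactor x ds) (Σ-cofactor d ds) ⟩
    head + (((x - d - + 1) * ∏- d ds) * ((∏- x ds - ∏- (x - + 1) ds) * V) + ∏- x ds * ((∏- d ds - ∏- (d - + 1) ds) * V))
      ≡⟨ collect x d (∏- x ds) (∏- (x - + 1) ds) (∏- d ds) (∏- (d - + 1) ds) V ⟩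
    ((x - d) * ∏- x ds - (x - + 1 - d) * ∏- (x - + 1) ds) * (∏- d ds * V) ∎
    where
    open ≡-Reasoning
    V = vandermonde ds
    head = ∏- x ds * (∏- (d - + 1) ds * V)
    -- Rests on `(x - d)(d - e + 1) = (x - d - 1)(d - e) + (x - e)`, which splits the tail into two
    -- instances of the induction hypothesis, at `x` and at `d`.
    poly : ∀ x d e a b v →
      (x - d) * a * ((d - e + + 1) * b * v) ≡ ((x - d - + 1) * ((d - e) * b)) * (a * v) + (x - e) * a * (b * v)
    poly = solve-∀
    tail-term : ∀ e o l → ∏- d ds ≡ (d - e) * ∏- d o → ∏- x ds ≡ (x - e) * ∏- x o → ∏- d l ≡ (d - e + + 1) * ∏- d o →
      (x - d) * ∏- x o * (∏- d l * vandermonde l)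
          ≡ ((x - d - + 1) * ∏- d ds) * (∏- x o * vandermonde l) + ∏- x ds * (∏- d o * vandermonde l)
    tail-term e o l eq₁ eq₂ eq₃ rewrite eq₁ | eq₂ | eq₃ = poly x d e (∏- x o) (∏- d o) (vandermonde l)
    collect : ∀ x d px px1 pd pd1 v →
      px * (pd1 * v) + (((x - d - + 1) * pd) * ((px - px1) * v) + px * ((pd - pd1) * v))
        ≡ ((x - d) * px - (x - + 1 - d) * px1) * (pd * v)
    collect = solve-∀

  -- Comparing coefficients of `x^(n-1)` in `Σ-cofactor` gives this; the induction reaches it using
  -- only the instance of `Σ-cofactor` at the head `d`.
  Σ-vandermonde : ∀ ds → Σ-lower (λ e o l → vandermonde l) ds ≡ + length ds * vandermonde ds
  Σ-vandermonde []       = refl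
  Σ-vandermonde (d ∷ ds) = begin
    ∏- (d - + 1) ds * V + Σ-lower (λ e o l → ∏- d l * vandermonde l) ds
      ≡⟨ cong (λ u → head + u) (Σ-lower-cong ds λ e o l (whole , lowered) → tail-term e o l (whole d) (lowered d)) ⟩
    ∏- (d - + 1) ds * V + Σ-lower (λ e o l → ∏- d ds * vandermonde l + + 1 * (∏- d o * vandermonde l)) ds
      ≡⟨ cong (λ u → head + u) (Σ-lower-linear (∏- d ds) (+ 1) (λ e o l → vandermonde l) (λ e o l → ∏- d o * vandermonde l) ds) ⟩
    ∏- (d - + 1) ds * V + (∏- d ds * Σ-lower (λ e o l → vandermonde l) ds + + 1 * Σ-lower (λ e o l → ∏- d o * vandermonde l) ds)
      ≡⟨ cong₂ (λ u v → ∏- (d - + 1) ds * V + (∏- d ds * u + + 1 * v)) (Σ-vandermonde ds) (Σ-cofactor d ds) ⟩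
    ∏- (d - + 1) ds * V + (∏- d ds * (+ length ds * V) + + 1 * ((∏- d ds - ∏- (d - + 1) ds) * V))
      ≡⟨ collect (∏- d ds) (∏- (d - + 1) ds) (+ length ds) V ⟩
    (+ 1 + + length ds) * (∏- d ds * V) ∎
    where
    open ≡-Reasoning
    V = vandermonde ds
    head = ∏- (d - + 1) ds * V
    poly : ∀ u b v → (u + + 1) * b * v ≡ u * b * v + + 1 * (b * v)
    poly = solve-∀
    tail-term : ∀ e o l → ∏- d ds ≡ (d - e) * ∏- d o → ∏- d l ≡ (d - e + + 1) * ∏- d o →
      ∏- d l * vandermonde l ≡ ∏- d ds * vandermonde l + + 1 * (∏- d o * vandermonde l)
    tail-term e o l eq₁ eq₂ rewrite eq₁ | eq₂ = poly (d - e) (∏- d o) (vandermonde l)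
    collect : ∀ p q n v → q * v + (p * (n * v) + + 1 * ((p - q) * v)) ≡ (+ 1 + n) * (p * v)
    collect = solve-∀

  -- The next coefficient, of `x^(n-2)`, in `Σ-cofactor`. In the induction,
  -- `e(d - e + 1) = (d - e)e - (d - e) + d` reduces the tail to three sums already known.
  Σ-weighted-vandermonde : ∀ ds →
    Σ-lower (λ e o l → e * vandermonde l) ds ≡ (sumℤ ds - + triangle (length ds)) * vandermonde ds
  Σ-weighted-vandermonde []       = refl
  Σ-weighted-vandermonde (d ∷ ds) = begin
    d * (∏- (d - + 1) ds * V) + Σ-lower (λ e o l → e * (∏- d l * vandermonde l)) ds
      ≡⟨ cong (λ u → head + u) (Σ-lower-cong ds λ e o l (whole , lowered) → tail-term e o l (whole d) (lowered d)) ⟩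
    d * (∏- (d - + 1) ds * V)
        + Σ-lower (λ e o l → + 1 * (∏- d ds * (e * vandermonde l) + (- ∏- d ds) * vandermonde l) + d * (∏- d o * vandermonde l)) ds
      ≡⟨ cong (λ u → head + u) (trans (Σ-lower-linear (+ 1) d
          (λ e o l → ∏- d ds * (e * vandermonde l) + (- ∏- d ds) * vandermonde l)
          (λ e o l → ∏- d o * vandermonde l) ds)
           (cong (λ u → + 1 * u + d * Σ-lower (λ e o l → ∏- d o * vandermonde l) ds)
               (Σ-lower-linear (∏- d ds) (- ∏- d ds) (λ e o l → e * vandermonde l) (λ e o l → vandermonde l) ds))) ⟩
    d * (∏- (d - + 1) ds * V)
        + (+ 1 * (∏- d ds * Σ-lower (λ e o l → e * vandermonde l) ds + (- ∏- d ds) * Σ-lower (λ e o l → vandermonde l) ds)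
        + d * Σ-lower (λ e o l → ∏- d o * vandermonde l) ds)
      ≡⟨ cong (λ u → head + u) (cong₂ (λ u v → + 1 * u + d * v)
           (cong₂ (λ u v → ∏- d ds * u + (- ∏- d ds) * v) (Σ-weighted-vandermonde ds) (Σ-vandermonde ds)) (Σ-cofactor d ds)) ⟩
    d * (∏- (d - + 1) ds * V) + (+ 1 * (∏- d ds * ((sumℤ ds - + triangle n) * V) + (- ∏- d ds) * (+ n * V))
        + d * ((∏- d ds - ∏- (d - + 1) ds) * V))
      ≡⟨ collect d (∏- d ds) (∏- (d - + 1) ds) (sumℤ ds) (+ triangle n) (+ n) V ⟩
    (d + sumℤ ds - (+ n + + triangle n)) * (∏- d ds * V)
      ≡⟨ cong (λ u → (d + sumℤ ds - u) * (∏- d ds * V)) (sym (ℤP.pos-+ n (triangle n))) ⟩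
    (d + sumℤ ds - + (n ℕ.+ triangle n)) * (∏- d ds * V) ∎
    where
    open ≡-Reasoning
    V = vandermonde ds
    head = d * (∏- (d - + 1) ds * V)
    n = length ds
    poly : ∀ d e b v → e * ((d - e + + 1) * b * v) ≡ + 1 * ((d - e) * b * (e * v) + (- ((d - e) * b)) * v) + d * (b * v)
    poly = solve-∀
    tail-term : ∀ e o l → ∏- d ds ≡ (d - e) * ∏- d o → ∏- d l ≡ (d - e + + 1) * ∏- d o →
      e * (∏- d l * vandermonde l)
          ≡ + 1 * (∏- d ds * (e * vandermonde l) + (- ∏- d ds) * vandermonde l) + d * (∏- d o * vandermonde l)
    tail-term e o l eq₁ eq₂ rewrite eq₁ | eq₂ = poly d e (∏- d o) (vandermonde l)
    collect : ∀ d p q s t n v →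
      d * (q * v) + (+ 1 * (p * ((s - t) * v) + (- p) * (n * v)) + d * ((p - q) * v)) ≡ (d + s - (n + t)) * (p * v)
    collect = solve-∀

  -- Finite weighted sums of points as linear functionals

  FormalSum : Set → Set
  FormalSum X = List (ℤ × X)

  private variable
    X Y Z : Set

  ⟨_,_⟩ : FormalSum X → (X → ℤ) → ℤ
  ⟨ []          , f ⟩ = + 0
  ⟨ (w , x) ∷ L , f ⟩ = w * f x + ⟨ L , f ⟩

  scale : ℤ → FormalSum X → FormalSum X
  scale s = map λ (w , x) → s * w , x

  push : (X → Y) → FormalSum X → FormalSum Y
  push g = map (map₂ g)

  tensor : (X → Y → Z) → FormalSum X → FormalSum Y → FormalSum Z
  tensor h []            M = []
  tensor h ((w , x) ∷ L) M = scale w (push (h x) M) ++ tensor h L M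

  ⟨⟩-cong : ∀ (L : FormalSum X) {f g} → (∀ x → f x ≡ g x) → ⟨ L , f ⟩ ≡ ⟨ L , g ⟩
  ⟨⟩-cong []            eq = refl
  ⟨⟩-cong ((w , x) ∷ L) eq = cong₂ _+_ (cong (w *_) (eq x)) (⟨⟩-cong L eq)

  ⟨⟩-+ : ∀ (L : FormalSum X) f g → ⟨ L , (λ x → f x + g x) ⟩ ≡ ⟨ L , f ⟩ + ⟨ L , g ⟩
  ⟨⟩-+ []            f g = refl
  ⟨⟩-+ ((w , x) ∷ L) f g rewrite ⟨⟩-+ L f g = regroup w (f x) (g x) ⟨ L , f ⟩ ⟨ L , g ⟩
    where
    regroup : ∀ w a b c d → w * (a + b) + (c + d) ≡ w * a + c + (w * b + d)
    regroup = solve-∀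

  ⟨⟩-* : ∀ (L : FormalSum X) s f → ⟨ L , (λ x → s * f x) ⟩ ≡ s * ⟨ L , f ⟩
  ⟨⟩-* []            s f = sym (ℤP.*-zeroʳ s)
  ⟨⟩-* ((w , x) ∷ L) s f rewrite ⟨⟩-* L s f = regroup w s (f x) ⟨ L , f ⟩
    where
    regroup : ∀ w s a b → w * (s * a) + s * b ≡ s * (w * a + b)
    regroup = solve-∀

  ⟨⟩-++ : ∀ (L M : FormalSum X) f → ⟨ L ++ M , f ⟩ ≡ ⟨ L , f ⟩ + ⟨ M , f ⟩
  ⟨⟩-++ []            M f = sym (ℤP.+-identityˡ _)
  ⟨⟩-++ ((w , x) ∷ L) M f rewrite ⟨⟩-++ L M f = sym (ℤP.+-assoc (w * f x) ⟨ L , f ⟩ ⟨ M , f ⟩)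

  ⟨⟩-scale : ∀ s (L : FormalSum X) f → ⟨ scale s L , f ⟩ ≡ s * ⟨ L , f ⟩
  ⟨⟩-scale s []            f = sym (ℤP.*-zeroʳ s)
  ⟨⟩-scale s ((w , x) ∷ L) f rewrite ⟨⟩-scale s L f = regroup s w (f x) ⟨ L , f ⟩
    where
    regroup : ∀ s w a b → s * w * a + s * b ≡ s * (w * a + b)
    regroup = solve-∀

  ⟨⟩-push : ∀ (g : X → Y) L f → ⟨ push g L , f ⟩ ≡ ⟨ L , (λ x → f (g x)) ⟩
  ⟨⟩-push g []            f = refl
  ⟨⟩-push g ((w , x) ∷ L) f = cong (λ u → w * f (g x) + u) (⟨⟩-push g L f)

  ⟨⟩-tensor : ∀ (h : X → Y → Z) L M f → ⟨ tensor h L M , f ⟩ ≡ ⟨ L , (λ x → ⟨ M , (λ y → f (h x y)) ⟩) ⟩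
  ⟨⟩-tensor h []            M f = refl
  ⟨⟩-tensor h ((w , x) ∷ L) M f = trans (⟨⟩-++ (scale w (push (h x) M)) (tensor h L M) f)
    (cong₂ _+_ (trans (⟨⟩-scale w (push (h x) M) f) (cong (w *_) (⟨⟩-push (h x) M f))) (⟨⟩-tensor h L M f))

  ⟨⟩-0 : ∀ (L : FormalSum X) → ⟨ L , (λ _ → + 0) ⟩ ≡ + 0
  ⟨⟩-0 L = ⟨⟩-* L (+ 0) (λ _ → + 0)

  ⟨⟩-swap : ∀ (L : FormalSum X) (M : FormalSum Y) (f : X → Y → ℤ) →
    ⟨ L , (λ x → ⟨ M , (λ y → f x y) ⟩) ⟩ ≡ ⟨ M , (λ y → ⟨ L , (λ x → f x y) ⟩) ⟩
  ⟨⟩-swap []            M f = sym (⟨⟩-0 M)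
  ⟨⟩-swap ((w , x) ∷ L) M f = trans
    (cong₂ _+_ (sym (⟨⟩-* M w (f x))) (⟨⟩-swap L M f))
    (sym (⟨⟩-+ M (λ y → w * f x y) (λ y → ⟨ L , (λ x → f x y) ⟩)))

  -- Congruence modulo p, and functionals with a product rule

  module Congruence (p : ℕ) where

    infix 4 _≈_ _≉_ _≈?_

    record _≈_ (x y : ℤ) : Set where
      constructor mod-p
      field p∣x-y : + p ∣ x - y

    _≉_ : ℤ → ℤ → Set
    x ≉ y = ¬ (x ≈ y)

    -- Reduces a congruence to an integer ring identity that exhibits the difference of its sides as
    -- a multiple of a known one.
    ≈-linear : ∀ {x y u v} s → u ≈ v → x - y ≡ s * (u - v) → x ≈ y
    ≈-linear s (mod-p d) eq = mod-p (subst (+ p ∣_) (sym eq) (∣n⇒∣m*n s d))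

    ≈-linear₂ : ∀ {x y u v u′ v′} s t → u ≈ v → u′ ≈ v′ → x - y ≡ s * (u - v) + t * (u′ - v′) → x ≈ y
    ≈-linear₂ s t (mod-p d) (mod-p e) eq = mod-p (subst (+ p ∣_) (sym eq) (∣m∣n⇒∣m+n (∣n⇒∣m*n s d) (∣n⇒∣m*n t e)))

    ≡⇒≈ : ∀ {x y} → x ≡ y → x ≈ y
    ≡⇒≈ {x} refl = mod-p (divides (+ 0) (ℤP.+-inverseʳ x))

    ≈-refl : ∀ {x} → x ≈ x
    ≈-refl = ≡⇒≈ refl

    ≈-sym : ∀ {x y} → x ≈ y → y ≈ x
    ≈-sym {x} {y} e = ≈-linear (- + 1) e (negate x y)
      where
      negate : ∀ x y → y - x ≡ - + 1 * (x - y)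
      negate = solve-∀

    ≈-trans : ∀ {x y z} → x ≈ y → y ≈ z → x ≈ z
    ≈-trans {x} {y} {z} e e′ = ≈-linear₂ (+ 1) (+ 1) e e′ (telescope x y z)
      where
      telescope : ∀ x y z → x - z ≡ + 1 * (x - y) + + 1 * (y - z)
      telescope = solve-∀

    +-cong-≈ : ∀ {x y u v} → x ≈ y → u ≈ v → x + u ≈ y + v
    +-cong-≈ {x} {y} {u} {v} e e′ = ≈-linear₂ (+ 1) (+ 1) e e′ (split x y u v)
      where
      split : ∀ x y u v → x + u - (y + v) ≡ + 1 * (x - y) + + 1 * (u - v)
      split = solve-∀

    *-cong-≈ : ∀ {x y u v} → x ≈ y → u ≈ v → x * u ≈ y * v
    *-cong-≈ {x} {y} {u} {v} e e′ = ≈-linear₂ u y e e′ (split x y u v)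
      where
      split : ∀ x y u v → x * u - y * v ≡ u * (x - y) + y * (u - v)
      split = solve-∀

    *-congˡ-≈ : ∀ s {x y} → x ≈ y → s * x ≈ s * y
    *-congˡ-≈ s = *-cong-≈ (≈-refl {s})

    _≈?_ : ∀ x y → Dec (x ≈ y)
    x ≈? y = map′ mod-p _≈_.p∣x-y (+ p ∣? (x - y))

    ≈-setoid : Setoid _ _
    ≈-setoid = record
      { Carrier = ℤ ; _≈_ = _≈_
      ; isEquivalence = record { refl = ≈-refl ; sym = ≈-sym ; trans = ≈-trans } }

    ⟨⟩-cong-≈ : ∀ {L : FormalSum X} {f g} → All (λ (w , x) → f x ≈ g x) L → ⟨ L , f ⟩ ≈ ⟨ L , g ⟩
    ⟨⟩-cong-≈ {L = []}          []       = ≈-refl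
    ⟨⟩-cong-≈ {L = (w , x) ∷ L} (e ∷ es) = +-cong-≈ (*-congˡ-≈ w e) (⟨⟩-cong-≈ es)

    ⟨⟩-≈0 : ∀ {L : FormalSum X} {f} → All (λ (w , x) → f x ≈ + 0) L → ⟨ L , f ⟩ ≈ + 0
    ⟨⟩-≈0 {L = L} es = ≈-trans (⟨⟩-cong-≈ es) (≡⇒≈ (⟨⟩-0 L))

    always : ∀ {P : X → Set} → (∀ x → P x) → (L : FormalSum X) → All (λ (w , x) → P x) L
    always h []      = []
    always h (_ ∷ L) = h _ ∷ always h L

    -- Off-diagonal terms cancel in pairs. Vanishing on the diagonal is a separate hypothesis
    -- because antisymmetry only yields `2 f x x ≈ 0`, which says nothing modulo 2.
    ⟨⟩-alternating : ∀ (L : FormalSum X) (f : X → X → ℤ) → (∀ x → f x x ≈ + 0) → (∀ x y → f x y + f y x ≈ + 0) →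
      ⟨ L , (λ x → ⟨ L , f x ⟩) ⟩ ≈ + 0
    ⟨⟩-alternating []            f diag alt = ≈-refl
    ⟨⟩-alternating ((w , x) ∷ L) f diag alt = begin
      w * (w * f x x + ⟨ L , f x ⟩) + ⟨ L , (λ y → w * f y x + ⟨ L , f y ⟩) ⟩
        ≡⟨ cong (λ u → w * (w * f x x + ⟨ L , f x ⟩) + u)
             (trans (⟨⟩-+ L (λ y → w * f y x) (λ y → ⟨ L , f y ⟩)) (cong (λ u → u + _) (⟨⟩-* L w (λ y → f y x)))) ⟩
      w * (w * f x x + ⟨ L , f x ⟩) + (w * ⟨ L , (λ y → f y x) ⟩ + ⟨ L , (λ y → ⟨ L , f y ⟩) ⟩)
        ≡⟨ regroup w (f x x) ⟨ L , f x ⟩ ⟨ L , (λ y → f y x) ⟩ ⟨ L , (λ y → ⟨ L , f y ⟩) ⟩ ⟩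
      w * w * f x x + (w * (⟨ L , f x ⟩ + ⟨ L , (λ y → f y x) ⟩) + ⟨ L , (λ y → ⟨ L , f y ⟩) ⟩)
        ≡⟨ cong (λ u → w * w * f x x + (w * u + _)) (sym (⟨⟩-+ L (f x) (λ y → f y x))) ⟩
      w * w * f x x + (w * ⟨ L , (λ y → f x y + f y x) ⟩ + ⟨ L , (λ y → ⟨ L , f y ⟩) ⟩)
        ≈⟨ +-cong-≈ (*-congˡ-≈ (w * w) (diag x)) (+-cong-≈ (*-congˡ-≈ w (⟨⟩-≈0 (always (alt x) L))) (⟨⟩-alternating L f diag alt)) ⟩
      w * w * + 0 + (w * + 0 + + 0)
        ≡⟨ zeros w ⟩
      + 0 ∎
      where
      open SetoidReasoning ≈-setoid
      regroup : ∀ w a b c d → w * (w * a + b) + (w * c + d) ≡ w * w * a + (w * (b + c) + d)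
      regroup = solve-∀
      zeros : ∀ w → w * w * + 0 + (w * + 0 + + 0) ≡ + 0
      zeros = solve-∀

    -- The passage from a nonzero functional to a grid point; `P` transports what is known of all
    -- its points, later the block lengths.
    ⟨⟩-≉0 : ∀ {P : X → Set} {L f} → All (λ (w , x) → P x) L → ⟨ L , f ⟩ ≉ + 0 → ∃[ x ] (P x × f x ≉ + 0)
    ⟨⟩-≉0 {L = []}          []       L≉0 with () ← L≉0 ≈-refl
    ⟨⟩-≉0 {L = (w , x) ∷ L} {f} (P ∷ Ps) L≉0 with f x ≈? + 0
    ... | no  fx≉0 = x , P , fx≉0
    ... | yes fx≈0 = ⟨⟩-≉0 Ps λ L≈0 → L≉0
      (≈-linear₂ w (+ 1) fx≈0 L≈0 (expand w (f x) ⟨ L , f ⟩))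
      where
      expand : ∀ w a b → w * a + b - + 0 ≡ w * (a - + 0) + + 1 * (b - + 0)
      expand = solve-∀

    -- Functionals indexed like divided differences: multiplication by the coordinate acts on
    -- them by a diagonal term plus a lowering of the index.
    record System : Set₁ where
      field
        Index Point : Set
        coordinate  : Point → ℤ
        diagonal    : Index → ℤ
        Ok          : Index → Set
        lower       : Index → FormalSum Index
        functional  : Index → FormalSum Point
        product-rule : ∀ {i} → Ok i → ∀ t f →
          ⟨ functional i , (λ x → (coordinate x + t) * f x) ⟩
            ≈ (diagonal i + t) * ⟨ functional i , f ⟩ + ⟨ lower i , (λ j → ⟨ functional j , f ⟩) ⟩

    -- Tensor powers of a system form a system again, with coordinates added. The construction is
    -- applied twice: to the points of a block, then to the blocks.
    module ListSystem (S : System) where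
      open System S

      coordinates : List Point → ℤ
      coordinates []       = + 0
      coordinates (x ∷ xs) = coordinate x + coordinates xs

      diagonals : List Index → ℤ
      diagonals []       = + 0
      diagonals (i ∷ is) = diagonal i + diagonals is

      lowers : List Index → FormalSum (List Index)
      lowers []       = []
      lowers (i ∷ is) = push (_∷ is) (lower i) ++ push (i ∷_) (lowers is)

      functionals : List Index → FormalSum (List Point)
      functionals []       = (+ 1 , []) ∷ []
      functionals (i ∷ is) = tensor _∷_ (functional i) (functionals is)

      functionals-∷ : ∀ i is f →
        ⟨ functionals (i ∷ is) , f ⟩ ≡ ⟨ functional i , (λ x → ⟨ functionals is , (λ xs → f (x ∷ xs)) ⟩) ⟩
      functionals-∷ i is f = ⟨⟩-tensor _∷_ (functional i) (functionals is) f

      -- For each factor the coordinates of the others are constants, and the free shift `t` absorbs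
      -- them: first the head coordinate during the recursion on the tail, then the tail's diagonal
      -- in the rule for the head.
      product-rules : ∀ {is} → All Ok is → ∀ t f →
        ⟨ functionals is , (λ xs → (coordinates xs + t) * f xs) ⟩
          ≈ (diagonals is + t) * ⟨ functionals is , f ⟩ + ⟨ lowers is , (λ js → ⟨ functionals js , f ⟩) ⟩
      product-rules []                          t f = ≡⇒≈ (unit t (f []))
        where
        unit : ∀ t a → + 1 * ((+ 0 + t) * a) + + 0 ≡ (+ 0 + t) * (+ 1 * a + + 0) + + 0
        unit = solve-∀
      product-rules {is = i ∷ is} (ok ∷ oks) t f = begin
        ⟨ functionals (i ∷ is) , (λ xs → (coordinates xs + t) * f xs) ⟩
          ≡⟨ functionals-∷ i is _ ⟩
        ⟨ functional i , (λ x → ⟨ functionals is , (λ xs → (coordinate x + coordinates xs + t) * f (x ∷ xs)) ⟩) ⟩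
          ≈⟨ ⟨⟩-cong-≈ (always inner (functional i)) ⟩
        ⟨ functional i , (λ x → (coordinate x + (diagonals is + t)) * F x + ⟨ lowers is , (λ js → F′ js x) ⟩) ⟩
          ≡⟨ ⟨⟩-+ (functional i) _ _ ⟩
        ⟨ functional i , (λ x → (coordinate x + (diagonals is + t)) * F x) ⟩ + ⟨ functional i , (λ x → ⟨ lowers is , (λ js → F′ js x) ⟩) ⟩
          ≈⟨ +-cong-≈ (product-rule ok (diagonals is + t) F) (≡⇒≈ (⟨⟩-swap (functional i) (lowers is) (λ x js → F′ js x))) ⟩
        (diagonal i + (diagonals is + t)) * ⟨ functional i , F ⟩ + ⟨ lower i , (λ j → ⟨ functional j , F ⟩) ⟩
          + ⟨ lowers is , (λ js → ⟨ functional i , F′ js ⟩) ⟩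
          ≡⟨ regroup (diagonal i) (diagonals is) t ⟨ functional i , F ⟩ _ _ ⟩
        (diagonal i + diagonals is + t) * ⟨ functional i , F ⟩
          + (⟨ lower i , (λ j → ⟨ functional j , F ⟩) ⟩ + ⟨ lowers is , (λ js → ⟨ functional i , F′ js ⟩) ⟩)
          ≡⟨ sym (cong₂ (λ u v → (diagonal i + diagonals is + t) * u + v) (functionals-∷ i is f) outer) ⟩
        (diagonals (i ∷ is) + t) * ⟨ functionals (i ∷ is) , f ⟩ + ⟨ lowers (i ∷ is) , (λ js → ⟨ functionals js , f ⟩) ⟩ ∎
        where
        open SetoidReasoning ≈-setoid
        F′ : List Index → Point → ℤ
        F′ js x = ⟨ functionals js , (λ xs → f (x ∷ xs)) ⟩
        F : Point → ℤ
        F = F′ is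
        reassoc : ∀ a b t w → (a + b + t) * w ≡ (b + (a + t)) * w
        reassoc = solve-∀
        regroup : ∀ a b t u v w → (a + (b + t)) * u + v + w ≡ (a + b + t) * u + (v + w)
        regroup = solve-∀
        inner : ∀ x → ⟨ functionals is , (λ xs → (coordinate x + coordinates xs + t) * f (x ∷ xs)) ⟩
                    ≈ (coordinate x + (diagonals is + t)) * F x + ⟨ lowers is , (λ js → F′ js x) ⟩
        inner x = begin
          ⟨ functionals is , (λ xs → (coordinate x + coordinates xs + t) * f (x ∷ xs)) ⟩
            ≡⟨ ⟨⟩-cong (functionals is) (λ xs → reassoc (coordinate x) (coordinates xs) t (f (x ∷ xs))) ⟩
          ⟨ functionals is , (λ xs → (coordinates xs + (coordinate x + t)) * f (x ∷ xs)) ⟩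
            ≈⟨ product-rules oks (coordinate x + t) (λ xs → f (x ∷ xs)) ⟩
          (diagonals is + (coordinate x + t)) * F x + ⟨ lowers is , (λ js → F′ js x) ⟩
            ≡⟨ cong (λ u → u + ⟨ lowers is , (λ js → F′ js x) ⟩) (sym (reassoc (coordinate x) (diagonals is) t (F x)))  ⟩
          (coordinate x + diagonals is + t) * F x + ⟨ lowers is , (λ js → F′ js x) ⟩
            ≡⟨ cong (λ u → u * F x + ⟨ lowers is , (λ js → F′ js x) ⟩) (ℤP.+-assoc (coordinate x) (diagonals is) t)  ⟩
          (coordinate x + (diagonals is + t)) * F x + ⟨ lowers is , (λ js → F′ js x) ⟩ ∎
        outer : ⟨ lowers (i ∷ is) , (λ js → ⟨ functionals js , f ⟩) ⟩
              ≡ ⟨ lower i , (λ j → ⟨ functional j , F ⟩) ⟩ + ⟨ lowers is , (λ js → ⟨ functional i , F′ js ⟩) ⟩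
        outer = trans (⟨⟩-++ (push (_∷ is) (lower i)) (push (i ∷_) (lowers is)) _) (cong₂ _+_
          (trans (⟨⟩-push (_∷ is) (lower i) _) (⟨⟩-cong (lower i) λ j → functionals-∷ j is f))
          (trans (⟨⟩-push (i ∷_) (lowers is) _) (⟨⟩-cong (lowers is) λ js → functionals-∷ i js f)))

      listSystem : System
      listSystem = record
        { coordinate = coordinates ; diagonal = diagonals ; Ok = All Ok
        ; lower = lowers ; functional = functionals ; product-rule = product-rules }

  All-tensor : ∀ {P : X → Set} {Q : Y → Set} {R : Z → Set} {h : X → Y → Z} {L M} → (∀ {x y} → P x → Q y → R (h x y)) →
    All (λ (w , x) → P x) L → All (λ (w , y) → Q y) M → All (λ (w , z) → R z) (tensor h L M)
  All-tensor r []       qs = []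
  All-tensor r (P ∷ ps) qs = AllP.++⁺ (AllP.map⁺ (AllP.map⁺ (All.map (r P) qs))) (All-tensor r ps qs)

  -- Strictly decreasing orders with a prescribed total

  vandermondes : (X → ℤ) → List (List X) → ℤ
  vandermondes g []         = + 1
  vandermondes g (xs ∷ xss) = vandermonde (map g xs) * vandermondes g xss

  total : List (List ℕ) → ℕ
  total []       = 0
  total (c ∷ cs) = sum c ℕ.+ total cs

  triangles : List (List X) → ℕ
  triangles []       = 0
  triangles (c ∷ cs) = triangle (length c) ℕ.+ triangles cs

  ∏-↭ : ∀ (g : X → ℤ) z {xs ys} → xs ↭ ys → ∏- z (map g xs) ≡ ∏- z (map g ys)
  ∏-↭ g z ↭.refl          = refl
  ∏-↭ g z (↭.prep x e)    = cong ((z - g x) *_) (∏-↭ g z e)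
  ∏-↭ g z (↭.swap x y e)  = trans (exchange (z - g x) (z - g y) _) (cong (λ u → (z - g y) * ((z - g x) * u)) (∏-↭ g z e))
    where
    exchange : ∀ a b c → a * (b * c) ≡ b * (a * c)
    exchange = solve-∀
  ∏-↭ g z (↭.trans e e′)  = trans (∏-↭ g z e) (∏-↭ g z e′)

  data Descending : ℕ → List ℕ → Set where
    []  : ∀ {b} → Descending b []
    _∷_ : ∀ {b n c} → n < b → Descending n c → Descending b (n ∷ c)

  -- Lowering an entry of a strictly decreasing sequence can make it equal to its right neighbour;
  -- such orders contribute nothing, because V is alternating.
  data Repeating : List ℕ → Set where
    here  : ∀ {n c} → Repeating (n ∷ n ∷ c)
    there : ∀ {n c} → Repeating c → Repeating (n ∷ c)

  Descending-mono : ∀ {b b′ c} → b ≤ b′ → Descending b c → Descending b′ c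
  Descending-mono b≤b′ []        = []
  Descending-mono b≤b′ (n<b ∷ d) = ℕP.<-≤-trans n<b b≤b′ ∷ d

  Descending-length : ∀ {b c} → Descending b c → length c ≤ b
  Descending-length []        = z≤n
  Descending-length (n<b ∷ d) = ℕP.≤-<-trans (Descending-length d) n<b

  -- Each entry is at least the number of entries after it.
  Descending-sum : ∀ {b c} → Descending b c → triangle (length c) ≤ sum c
  Descending-sum []        = z≤n
  Descending-sum (n<b ∷ d) = ℕP.+-mono-≤ (Descending-length d) (Descending-sum d)

  Descending-pred : ∀ {n c} → Descending (suc n) c → Descending n c ⊎ Repeating (n ∷ c)
  Descending-pred []              = inj₁ []
  Descending-pred (s≤s m≤n ∷ d) with ℕP.m≤n⇒m<n∨m≡n m≤n
  ... | inj₁ m<n  = inj₁ (m<n ∷ d)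
  ... | inj₂ refl = inj₂ here

  vandermonde-repeating : ∀ {c} → Repeating c → vandermonde (map pos c) ≡ + 0
  vandermonde-repeating (here {n} {c})  = vanish (+ n) (∏- (+ n) (map pos c)) _
    where
    vanish : ∀ n a b → (n - n) * a * b ≡ + 0
    vanish = solve-∀
  vandermonde-repeating (there {n} {c} r) = trans (cong (∏- (+ n) (map pos c) *_) (vandermonde-repeating r))
      (ℤP.*-zeroʳ (∏- (+ n) (map pos c)))

  vandermondes-repeating : ∀ {cs} → Any Repeating cs → vandermondes pos cs ≡ + 0
  vandermondes-repeating {c ∷ cs} (here r)  = cong (_* vandermondes pos cs) (vandermonde-repeating r)
  vandermondes-repeating {c ∷ cs} (there r) = trans (cong (vandermonde (map pos c) *_) (vandermondes-repeating r))
      (ℤP.*-zeroʳ (vandermonde (map pos c)))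

  sumℤ-+ : ∀ c → sumℤ (map pos c) ≡ + sum c
  sumℤ-+ []      = refl
  sumℤ-+ (n ∷ c) = cong (λ u → + n + u) (sumℤ-+ c)

  -- A strictly decreasing sequence of n numbers below n is n - 1, …, 0.
  ∏-staircase : ∀ m {n c} → Descending n c → length c ≡ n → ∏- (+ (m ℕ.+ n)) (map pos c) * + (m !) ≡ + ((m ℕ.+ n) !)
  ∏-staircase m []                  refl rewrite ℕP.+-identityʳ m = ℤP.*-identityˡ _
  ∏-staircase m (_∷_ {n = n} {c} (s≤s n≤l) d) refl
    rewrite ℕP.≤-antisym n≤l (Descending-length d) | ℕP.+-suc m (length c) = begin
    (+ suc (m ℕ.+ l) - + l) * P * + (m !)  ≡⟨ cong (λ u → u * P * + (m !)) difference ⟩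
    + suc m * P * + (m !)                  ≡⟨ regroup (+ suc m) P (+ (m !)) ⟩
    P * (+ suc m * + (m !))                ≡⟨ cong (P *_) (sym (ℤP.pos-* (suc m) (m !))) ⟩
    P * + (suc m !)                        ≡⟨ ∏-staircase (suc m)
        (subst (λ u → Descending u c) (ℕP.≤-antisym n≤l (Descending-length d)) d) refl ⟩
    + (suc (m ℕ.+ l) !)                    ∎
    where
    open ≡-Reasoning
    l = length c
    P = ∏- (+ suc (m ℕ.+ l)) (map pos c)
    cancel : ∀ a b → a + b - b ≡ a
    cancel = solve-∀
    difference : + suc (m ℕ.+ l) - + l ≡ + suc m
    difference = cancel (+ suc m) (+ l)
    regroup : ∀ a b c → a * b * c ≡ b * (a * c)
    regroup = solve-∀

  -- The orders are the staircase h - 1, …, 0 plus a partition of s inside an h × d box.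
  fill : ∀ h d s → s ≤ h ℕ.* d → ∃[ c ] (Descending (h ℕ.+ d) c × length c ≡ h × sum c ≡ s ℕ.+ triangle h)
  fill zero    d       zero z≤n = [] , [] , refl , refl
  -- Greedy choice of the partition: if `s` reaches the width `d`, the first part is a full `d`;
  -- otherwise every part fits a box that is narrower by one.
  fill (suc h) d       s    s≤  with d ℕP.≤? s
  ... | yes d≤s with c , desc , len , total≡ ← fill h d (s ∸ d) (ℕP.m≤n+o⇒m∸n≤o s d s≤) =
    h ℕ.+ d ∷ c , ℕP.n<1+n _ ∷ desc , cong suc len , (begin
      h ℕ.+ d ℕ.+ sum c                       ≡⟨ cong (h ℕ.+ d ℕ.+_) total≡ ⟩
      h ℕ.+ d ℕ.+ (s ∸ d ℕ.+ triangle h)      ≡⟨ regroup h d (s ∸ d) (triangle h) ⟩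
      d ℕ.+ (s ∸ d) ℕ.+ (h ℕ.+ triangle h)    ≡⟨ cong (ℕ._+ (h ℕ.+ triangle h)) (ℕP.m+[n∸m]≡n d≤s) ⟩
      s ℕ.+ (h ℕ.+ triangle h)                ∎)
    where
    open ≡-Reasoning
    regroup : ∀ h d u t → h ℕ.+ d ℕ.+ (u ℕ.+ t) ≡ d ℕ.+ u ℕ.+ (h ℕ.+ t)
    regroup = ℕSolver.solve-∀
  fill (suc h) zero    s    s≤ | no d≰s = contradiction z≤n d≰s
  fill (suc h) (suc d) s    s≤ | no d≰s =
    map₂ (λ (desc , rest) → Descending-mono (s≤s (ℕP.+-monoʳ-≤ h (ℕP.n≤1+n d))) desc , rest)
      (fill (suc h) d s (ℕP.≤-trans (ℕ.s≤s⁻¹ (ℕP.≰⇒> d≰s)) (ℕP.m≤m+n d (h ℕ.* d))))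

  -- The largest sum of `h` distinct orders below `k` exceeds the staircase sum by `h (k - h)`. So
  -- this is the greatest number of linear factors that the orders can absorb.
  capacity : ℕ → List ℕ → ℕ
  capacity k []       = 0
  capacity k (h ∷ hs) = h ℕ.* (k ∸ h) ℕ.+ capacity k hs

  fills : ∀ k hs s → All (_≤ k) hs → s ≤ capacity k hs →
    ∃[ cs ] (All (Descending k) cs × map length cs ≡ hs × total cs ≡ s ℕ.+ triangles cs)
  fills k []       zero []         z≤n = [] , [] , refl , refl
  fills k (h ∷ hs) s    (h≤k ∷ hs≤k) s≤ =
    let s₁ = h ℕ.* (k ∸ h) ⊓ s
        c , desc , len , sum≡ = fill h (k ∸ h) s₁ (ℕP.m⊓n≤m _ s)
        cs , descs , lens , total≡ = fills k hs (s ∸ h ℕ.* (k ∸ h)) hs≤k (ℕP.m≤n+o⇒m∸n≤o s (h ℕ.* (k ∸ h)) s≤)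
    in c ∷ cs , subst (λ u → Descending u c) (ℕP.m+[n∸m]≡n h≤k) desc ∷ descs , cong₂ _∷_ len lens , (begin
      sum c ℕ.+ total cs
        ≡⟨ cong₂ ℕ._+_ sum≡ total≡ ⟩
      s₁ ℕ.+ triangle h ℕ.+ (s ∸ h ℕ.* (k ∸ h) ℕ.+ triangles cs)
        ≡⟨ regroup s₁ (triangle h) (s ∸ h ℕ.* (k ∸ h)) (triangles cs) ⟩
      s₁ ℕ.+ (s ∸ h ℕ.* (k ∸ h)) ℕ.+ (triangle h ℕ.+ triangles cs)
        ≡⟨ cong₂ (λ u l → u ℕ.+ (triangle l ℕ.+ triangles cs)) (ℕP.m⊓n+n∸m≡n (h ℕ.* (k ∸ h)) s) (sym len) ⟩
      s ℕ.+ (triangle (length c) ℕ.+ triangles cs) ∎)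
    where
    open ≡-Reasoning
    regroup : ∀ a b c d → a ℕ.+ b ℕ.+ (c ℕ.+ d) ≡ a ℕ.+ c ℕ.+ (b ℕ.+ d)
    regroup = ℕSolver.solve-∀

  -- Arithmetic modulo a prime

  module PrimeField (p : ℕ) (pp : Prime p) where
    open Congruence p

    ≈0⇒∣ : ∀ {x} → x ≈ + 0 → p ℕD.∣ ∣ x ∣
    ≈0⇒∣ {x} (mod-p d) = ∣⇒∣ᵤ (subst (+ p ∣_) (ℤP.+-identityʳ x) d)

    ∣⇒≈0 : ∀ {x} → p ℕD.∣ ∣ x ∣ → x ≈ + 0
    ∣⇒≈0 {x} d = mod-p (subst (+ p ∣_) (sym (ℤP.+-identityʳ x)) (∣ᵤ⇒∣ d))

    *-≉0 : ∀ {x y} → x ≉ + 0 → y ≉ + 0 → x * y ≉ + 0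
    *-≉0 {x} {y} x≉0 y≉0 xy≈0 =
      [ (λ d → x≉0 (∣⇒≈0 d)) , (λ d → y≉0 (∣⇒≈0 d)) ]′
        (euclidsLemma ∣ x ∣ ∣ y ∣ pp (subst (p ℕD.∣_) (ℤP.abs-* x y) (≈0⇒∣ xy≈0)))

    small-≉0 : ∀ {n} → suc n < p → + suc n ≉ + 0
    small-≉0 n<p n≈0 = ℕP.<⇒≱ n<p (ℕD.∣⇒≤ (≈0⇒∣ n≈0))

    1≉0 : + 1 ≉ + 0
    1≉0 1≈0 = ¬prime[1] (subst Prime (ℕD.∣1⇒≡1 (≈0⇒∣ 1≈0)) pp)

    !-≉0 : ∀ {n} → n < p → + (n !) ≉ + 0
    !-≉0 {zero}  n<p = 1≉0
    !-≉0 {suc n} n<p = subst (_≉ + 0) (sym (ℤP.pos-* (suc n) (n !)))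
      (*-≉0 (small-≉0 n<p) (!-≉0 (ℕP.<-trans (ℕP.n<1+n n) n<p)))

    inverse : ∀ x → x ≉ + 0 → ∃[ y ] x * y ≈ + 1
    inverse x x≉0 = from-Bézout (coprime-Bézout coprime)
      where
      coprime : Coprime ∣ x ∣ p
      coprime (d∣x , d∣p) with prime⇒irreducible pp d∣p
      ... | inj₁ d≡1  = d≡1
      ... | inj₂ refl = contradiction (∣⇒≈0 d∣x) x≉0
      signed : ∀ x → ∃[ s ] + ∣ x ∣ ≡ s * x
      signed (+ n)    = + 1 , sym (ℤP.*-identityˡ (+ n))
      signed -[1+ n ] = - + 1 , sym (ℤP.-1*i≡-i -[1+ n ])
      from-Bézout : Bézout.Identity 1 ∣ x ∣ p → ∃[ y ] x * y ≈ + 1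
      from-Bézout (Bézout.+- u v eq) with s , abs ← signed x =
        + u * s , mod-p (divides (+ v) (trans (cong (_- + 1) product) (cancel (+ v) (+ p))))
        where
        exchange : ∀ x u s → x * (u * s) ≡ u * (s * x)
        exchange = solve-∀
        cancel : ∀ v p → + 1 + v * p - + 1 ≡ v * p
        cancel = solve-∀
        product : x * (+ u * s) ≡ + 1 + + v * + p
        product = trans (exchange x (+ u) s) (trans (cong (+ u *_) (sym abs))
          (trans (sym (ℤP.pos-* u ∣ x ∣)) (trans (cong +_ (sym eq)) (cong (λ z → + 1 + z) (ℤP.pos-* v p)))))
      from-Bézout (Bézout.-+ u v eq) with s , abs ← signed x =
        - (+ u * s) , mod-p (divides (- + v)
            (trans (exchange x (+ u) s) (trans (cong -_ product) (ℤP.neg-distribˡ-* (+ v) (+ p)))))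
        where
        exchange : ∀ x u s → x * (- (u * s)) - + 1 ≡ - (+ 1 + u * (s * x))
        exchange = solve-∀
        product : + 1 + + u * (s * x) ≡ + v * + p
        product = trans (cong (λ z → + 1 + + u * z) (sym abs))
          (trans (cong (λ z → + 1 + z) (sym (ℤP.pos-* u ∣ x ∣))) (trans (cong +_ eq) (ℤP.pos-* v p)))

    -- Junk value 0 on multiples of p.
    invert : ℤ → ℤ
    invert x with x ≈? + 0
    ... | yes _  = + 0
    ... | no x≉0 = proj₁ (inverse x x≉0)

    *-invert : ∀ x → x ≉ + 0 → x * invert x ≈ + 1
    *-invert x x≉0 with x ≈? + 0
    ... | yes x≈0 = contradiction x≈0 x≉0
    ... | no x≉0′ = proj₂ (inverse x x≉0′)

    *-≉0ˡ : ∀ {x y} → x * y ≉ + 0 → x ≉ + 0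
    *-≉0ˡ {x} {y} xy≉0 x≈0 = xy≉0 (*-cong-≈ x≈0 (≈-refl {y}))

    *-≉0ʳ : ∀ {x y} → x * y ≉ + 0 → y ≉ + 0
    *-≉0ʳ {x} {y} xy≉0 y≈0 = xy≉0 (≈-trans (*-congˡ-≈ x y≈0) (≡⇒≈ (ℤP.*-zeroʳ x)))

    -- Every factor is `n - m` with `m < n < p`, hence positive and smaller than `p`.
    ∏-≉0 : ∀ {b c n} → Descending b c → b ≤ n → n < p → ∏- (+ n) (map pos c) ≉ + 0
    ∏-≉0                         []                      b≤n n<p = 1≉0
    ∏-≉0 {c = m ∷ c} {n} (m<b ∷ d) b≤n n<p with o , refl ← ℕP.m≤n⇒∃[o]m+o≡n (ℕP.<-≤-trans m<b b≤n) =
      *-≉0 (subst (_≉ + 0) (sym (cancel (+ m) (+ o))) (small-≉0 (ℕP.≤-<-trans (s≤s (ℕP.m≤n+m o m)) n<p)))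
        (∏-≉0 d (ℕP.<⇒≤ (ℕP.<-≤-trans m<b b≤n)) n<p)
      where
      cancel : ∀ m o → + 1 + (m + o) - m ≡ + 1 + o
      cancel = solve-∀

    vandermonde-≉0 : ∀ {b c} → Descending b c → b ≤ p → vandermonde (map pos c) ≉ + 0
    vandermonde-≉0 []        b≤p = 1≉0
    vandermonde-≉0 (n<b ∷ d) b≤p = *-≉0 (∏-≉0 d ℕP.≤-refl (ℕP.<-≤-trans n<b b≤p))
      (vandermonde-≉0 d (ℕP.≤-trans (ℕP.<⇒≤ n<b) b≤p))

    vandermondes-≉0 : ∀ {k cs} → k ≤ p → All (Descending k) cs → vandermondes pos cs ≉ + 0
    vandermondes-≉0 k≤p []       = 1≉0
    vandermondes-≉0 k≤p (D ∷ Ds) = *-≉0 (vandermonde-≉0 D k≤p) (vandermondes-≉0 k≤p Ds)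

    ∏-∈ : ∀ x {t ts} → t ∈ ts → x ≈ t → ∏- x ts ≈ + 0
    ∏-∈ x {t} (here {xs = ts} refl) x≈t = ≈-linear (∏- x ts) x≈t (expand x t (∏- x ts))
      where
      expand : ∀ x t a → (x - t) * a - + 0 ≡ a * (x - t)
      expand = solve-∀
    ∏-∈ x (there {x = t} t∈ts)      x≈t = ≈-trans (*-congˡ-≈ (x - t) (∏-∈ x t∈ts x≈t)) (≡⇒≈ (ℤP.*-zeroʳ (x - t)))

    -- The difference of two residues is smaller than `p` in absolute value, and 0 is the only such
    -- multiple of `p`.
    residues-distinct : ∀ {x y : Fin p} → + toℕ x - + toℕ y ≈ + 0 → x ≡ y
    residues-distinct {x} {y} x-y≈0 = FinP.toℕ-injective
        (ℤP.+-injective (ℤP.i-j≡0⇒i≡j (+ toℕ x) (+ toℕ y) (ℤP.∣i∣≡0⇒i≡0 zero-abs)))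
      where
      bounded : ∣ + toℕ x - + toℕ y ∣ < p
      bounded rewrite ℤP.m-n≡m⊖n (toℕ x) (toℕ y) =
        ℕP.≤-<-trans (ℤP.∣m⊝n∣≤m⊔n (toℕ x) (toℕ y)) (ℕP.⊔-lub (FinP.toℕ<n x) (FinP.toℕ<n y))
      multiple-small : ∀ n → p ℕD.∣ n → n < p → n ≡ 0
      multiple-small zero    d n<p = refl
      multiple-small (suc n) d n<p = contradiction (ℕD.∣⇒≤ d) (ℕP.<⇒≱ n<p)
      zero-abs : ∣ + toℕ x - + toℕ y ∣ ≡ 0
      zero-abs = multiple-small _ (≈0⇒∣ x-y≈0) bounded

    -- Divided differences

    module DividedDifference {X : Set} (value : X → ℤ) (node : ℕ → X) (k : ℕ)
      (distinct : ∀ {i j} → i < j → j < k → value (node j) - value (node i) ≉ + 0) where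

      v : ℕ → ℤ
      v i = value (node i)

      -- n! times the divided difference at the nodes i, …, i + n.
      difference : ℕ → ℕ → FormalSum X
      difference i zero    = (+ 1 , node i) ∷ []
      difference i (suc n) = scale (+ suc n * invert (v (suc (i ℕ.+ n)) - v i))
        (difference (suc i) n ++ scale (- + 1) (difference i n))

      difference-suc : ∀ i n f → ⟨ difference i (suc n) , f ⟩
        ≡ (+ suc n * invert (v (suc (i ℕ.+ n)) - v i)) * (⟨ difference (suc i) n , f ⟩ - ⟨ difference i n , f ⟩)
      difference-suc i n f = trans (⟨⟩-scale c (D′ ++ scale (- + 1) D) f) (cong (c *_)
        (trans (⟨⟩-++ D′ (scale (- + 1) D) f) (cong (λ u → ⟨ D′ , f ⟩ + u)
          (trans (⟨⟩-scale (- + 1) D f) (ℤP.-1*i≡-i _)))))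
        where
        c = + suc n * invert (v (suc (i ℕ.+ n)) - v i)
        D = difference i n
        D′ = difference (suc i) n

      -- The coefficient is `n! / (n-1)!`, the ratio between the scalings of consecutive orders.
      lowerℕ : ℕ → FormalSum ℕ
      lowerℕ zero    = []
      lowerℕ (suc n) = (+ suc n , n) ∷ []

      -- The defining recursion with its denominator multiplied out. Phrased through `lowerℕ`, it
      -- also covers order 0, where both sides vanish.
      difference-spread : ∀ i n f → i ℕ.+ n < k →
        (v (i ℕ.+ n) - v i) * ⟨ difference i n , f ⟩
          ≈ ⟨ lowerℕ n , (λ m → ⟨ difference (suc i) m , f ⟩) ⟩ - ⟨ lowerℕ n , (λ m → ⟨ difference i m , f ⟩) ⟩
      difference-spread i zero    f i<k rewrite ℕP.+-identityʳ i = ≡⇒≈ (vanish (v i) _)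
        where
        vanish : ∀ a b → (a - a) * b ≡ + 0
        vanish = solve-∀
      difference-spread i (suc n) f i<k rewrite ℕP.+-suc i n | difference-suc i n f =
        ≈-linear (+ suc n * (A - B)) (*-invert δ (distinct (s≤s (ℕP.m≤m+n i n)) i<k)) (expand δ (invert δ) (+ suc n) A B)
        where
        A = ⟨ difference (suc i) n , f ⟩
        B = ⟨ difference i n , f ⟩
        δ = v (suc (i ℕ.+ n)) - v i
        expand : ∀ d e c a b → d * (c * e * (a - b)) - (c * a + + 0 - (c * b + + 0)) ≡ c * (a - b) * (d * e - + 1)
        expand = solve-∀

      -- The Leibniz rule for divided differences. The diagonal is the last node and the lowered
      -- functional drops that node, so from `i = 0` only prefixes arise. The induction needs all
      -- `i` because the recursion moves the left end.
      difference-rule : ∀ i n → i ℕ.+ n < k → ∀ t f →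
        ⟨ difference i n , (λ x → (value x + t) * f x) ⟩
          ≈ (v (i ℕ.+ n) + t) * ⟨ difference i n , f ⟩ + ⟨ lowerℕ n , (λ m → ⟨ difference i m , f ⟩) ⟩
      difference-rule i zero    i<k t f rewrite ℕP.+-identityʳ i = ≡⇒≈ (unit (v i + t) (f (node i)))
        where
        unit : ∀ a b → + 1 * (a * b) + + 0 ≡ a * (+ 1 * b + + 0) + + 0
        unit = solve-∀
      difference-rule i (suc n) i<k t f
        rewrite ℕP.+-suc i n | difference-suc i n f | difference-suc i n (λ x → (value x + t) * f x) = begin
        c * e * (⟨ difference (suc i) n , xf ⟩ - ⟨ difference i n , xf ⟩)
          ≈⟨ ≈-linear₂ (c * e) (- (c * e)) (difference-rule (suc i) n i<k t f) (difference-rule i n i+n<k t f)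
               (substitute (c * e) ⟨ difference (suc i) n , xf ⟩ ⟨ difference i n , xf ⟩
                   ((vt + t) * A + A′) ((v (i ℕ.+ n) + t) * B + B′)) ⟩
        c * e * (((vt + t) * A + A′) - ((v (i ℕ.+ n) + t) * B + B′))
          -- By `difference-spread`, `A′ - B′` is `(v (i + n) - v i) B`. Together with the
          -- `(vt - v (i + n)) B` left over from the diagonals it makes `(vt - v i) B`, whose factor
          -- the inverse `e` cancels.
          ≈⟨ ≈-linear₂ (- (c * e)) (c * B) (difference-spread i n f i+n<k) (*-invert (vt - v i) (distinct (s≤s (ℕP.m≤m+n i n)) i<k))
               (expand c e t vt (v (i ℕ.+ n)) (v i) A B A′ B′) ⟩
        (vt + t) * (c * e * (A - B)) + (c * B + + 0) ∎
        where
        open SetoidReasoning ≈-setoid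
        xf : X → ℤ
        xf x = (value x + t) * f x
        i+n<k : i ℕ.+ n < k
        i+n<k = ℕP.<-trans (ℕP.n<1+n _) i<k
        c = + suc n
        vt = v (suc (i ℕ.+ n))
        e = invert (vt - v i)
        A = ⟨ difference (suc i) n , f ⟩
        B = ⟨ difference i n , f ⟩
        A′ = ⟨ lowerℕ n , (λ m → ⟨ difference (suc i) m , f ⟩) ⟩
        B′ = ⟨ lowerℕ n , (λ m → ⟨ difference i m , f ⟩) ⟩
        substitute : ∀ s a b a′ b′ → s * (a - b) - s * (a′ - b′) ≡ s * (a - a′) + (- s) * (b - b′)
        substitute = solve-∀
        expand : ∀ c e t vt vn vi a b a′ b′ →
          c * e * (((vt + t) * a + a′) - ((vn + t) * b + b′)) - ((vt + t) * (c * e * (a - b)) + (c * b + + 0))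
            ≡ (- (c * e)) * ((vn - vi) * b - (a′ - b′)) + c * b * ((vt - vi) * e - + 1)
        expand = solve-∀

      system : System
      system = record
        { coordinate = value ; diagonal = v ; Ok = _< k ; lower = lowerℕ
        ; functional = difference 0 ; product-rule = λ {n} → difference-rule 0 n }

      difference-1 : ∀ i n → ⟨ difference i (suc n) , (λ _ → + 1) ⟩ ≡ + 0
      difference-1 i n = trans (difference-suc i n (λ _ → + 1)) (trans (cong (c *_) (cancel n)) (ℤP.*-zeroʳ c))
        where
        c = + suc n * invert (v (suc (i ℕ.+ n)) - v i)
        cancel : ∀ n → ⟨ difference (suc i) n , (λ _ → + 1) ⟩ - ⟨ difference i n , (λ _ → + 1) ⟩ ≡ + 0
        cancel zero    = refl
        cancel (suc n) = cong₂ _-_ (difference-1 (suc i) n) (difference-1 i n)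

      -- Peeling off a linear factor lowers the degree by one and the order by at most one, so the
      -- order stays above the degree down to the constant case.
      difference-low-degree : ∀ n ys → n < k → length ys < n → ⟨ difference 0 n , (λ x → ∏- (value x) ys) ⟩ ≈ + 0
      difference-low-degree (suc n) []       n<k l<n       = ≡⇒≈ (difference-1 0 n)
      difference-low-degree (suc n) (y ∷ ys) n<k (s≤s l<n) = begin
        ⟨ difference 0 (suc n) , (λ x → (value x - y) * ∏- (value x) ys) ⟩
          ≈⟨ difference-rule 0 (suc n) n<k (- y) (λ x → ∏- (value x) ys) ⟩
        (v (suc n) - y) * ⟨ difference 0 (suc n) , (λ x → ∏- (value x) ys) ⟩
            + (+ suc n * ⟨ difference 0 n , (λ x → ∏- (value x) ys) ⟩ + + 0)
          ≈⟨ +-cong-≈ (*-congˡ-≈ (v (suc n) - y) (difference-low-degree (suc n) ys n<k (ℕP.<-trans l<n (ℕP.n<1+n n))))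
               (+-cong-≈ (*-congˡ-≈ (+ suc n) (difference-low-degree n ys (ℕP.<-trans (ℕP.n<1+n n) n<k) l<n)) ≈-refl) ⟩
        (v (suc n) - y) * + 0 + (+ suc n * + 0 + + 0)
          ≡⟨ zeros (v (suc n) - y) (+ suc n) ⟩
        + 0 ∎
        where
        open SetoidReasoning ≈-setoid
        zeros : ∀ a b → a * + 0 + (b * + 0 + + 0) ≡ + 0
        zeros = solve-∀

      -- The same peeling: the diagonal term has degree below its order and dies, and each lowered
      -- term contributes one factor of the factorial.
      difference-monic : ∀ n ys → n < k → length ys ≡ n → ⟨ difference 0 n , (λ x → ∏- (value x) ys) ⟩ ≈ + (n !)
      difference-monic zero    []       n<k refl = ≈-refl
      difference-monic (suc n) (y ∷ ys) n<k refl = begin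
        ⟨ difference 0 (suc n) , (λ x → (value x - y) * ∏- (value x) ys) ⟩
          ≈⟨ difference-rule 0 (suc n) n<k (- y) (λ x → ∏- (value x) ys) ⟩
        (v (suc n) - y) * ⟨ difference 0 (suc n) , (λ x → ∏- (value x) ys) ⟩
            + (+ suc n * ⟨ difference 0 n , (λ x → ∏- (value x) ys) ⟩ + + 0)
          ≈⟨ +-cong-≈ (*-congˡ-≈ (v (suc n) - y) (difference-low-degree (suc n) ys n<k ℕP.≤-refl))
               (+-cong-≈ (*-congˡ-≈ (+ suc n) (difference-monic n ys (ℕP.<-trans (ℕP.n<1+n n) n<k) refl)) ≈-refl) ⟩
        (v (suc n) - y) * + 0 + (+ suc n * + (n !) + + 0)
          ≡⟨ zeros (v (suc n) - y) (+ suc n) (+ (n !)) ⟩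
        + suc n * + (n !)
          ≡⟨ sym (ℤP.pos-* (suc n) (n !)) ⟩
        + (suc n !) ∎
        where
        open SetoidReasoning ≈-setoid
        zeros : ∀ a b c → a * + 0 + (b * c + + 0) ≡ b * c
        zeros = solve-∀

      -- Tensor products of divided differences over blocks

      module Block  = ListSystem system
      module Blocks = ListSystem Block.listSystem

      Block-length : ∀ c → All (λ (w , xs) → length xs ≡ length c) (Block.functionals c)
      Block-length []      = refl ∷ []
      Block-length (n ∷ c) = All-tensor (λ _ → cong suc) (always (λ _ → tt) (difference 0 n)) (Block-length c)

      Blocks-length : ∀ cs → All (λ (w , xss) → map length xss ≡ map length cs) (Blocks.functionals cs)
      Blocks-length []       = refl ∷ []
      Blocks-length (c ∷ cs) = All-tensor (cong₂ _∷_) (Block-length c) (Blocks-length cs)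

      coordinates-↭ : ∀ {xs ys} → xs ↭ ys → Block.coordinates xs ≡ Block.coordinates ys
      coordinates-↭ ↭.refl         = refl
      coordinates-↭ (↭.prep x e)   = cong (λ u → value x + u) (coordinates-↭ e)
      coordinates-↭ (↭.swap x y e) = trans (exchange (value x) (value y) _)
          (cong (λ u → value y + (value x + u)) (coordinates-↭ e))
        where
        exchange : ∀ a b c → a + (b + c) ≡ b + (a + c)
        exchange = solve-∀
      coordinates-↭ (↭.trans e e′) = trans (coordinates-↭ e) (coordinates-↭ e′)

      -- Equal neighbouring orders apply the same functional to two points in which the Vandermonde
      -- product is antisymmetric. The symmetric `g` collects the factors contributed by the points
      -- already passed.
      Block-repeating : ∀ {c} → Repeating c → (g : List X → ℤ) → (∀ {xs ys} → xs ↭ ys → g xs ≡ g ys) →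
        ⟨ Block.functionals c , (λ xs → g xs * vandermonde (map value xs)) ⟩ ≈ + 0
      Block-repeating (here {n} {c}) g g-↭ = begin
        ⟨ Block.functionals (n ∷ n ∷ c) , F ⟩
          ≡⟨ Block.functionals-∷ n (n ∷ c) F ⟩
        ⟨ difference 0 n , (λ x → ⟨ Block.functionals (n ∷ c) , (λ xs → F (x ∷ xs)) ⟩) ⟩
          ≡⟨ ⟨⟩-cong (difference 0 n) (λ x → Block.functionals-∷ n c (λ xs → F (x ∷ xs))) ⟩
        ⟨ difference 0 n , (λ x → ⟨ difference 0 n , (λ y → ⟨ Φ , (λ xs → F (x ∷ y ∷ xs)) ⟩) ⟩) ⟩
          ≈⟨ ⟨⟩-alternating (difference 0 n) (λ x y → ⟨ Φ , (λ xs → F (x ∷ y ∷ xs)) ⟩)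
               (λ x → ≡⇒≈ (diagonal x)) (λ x y → ≡⇒≈ (antisymmetric x y)) ⟩
        + 0 ∎
        where
        open SetoidReasoning ≈-setoid
        Φ = Block.functionals c
        F : List X → ℤ
        F xs = g xs * vandermonde (map value xs)
        vanish : ∀ g a p v → g * ((a - a) * p * v) ≡ + 0
        vanish = solve-∀
        opposite : ∀ g a b p q v → g * ((a - b) * p * (q * v)) + g * ((b - a) * q * (p * v)) ≡ + 0
        opposite = solve-∀
        diagonal : ∀ x → ⟨ Φ , (λ xs → F (x ∷ x ∷ xs)) ⟩ ≡ + 0
        diagonal x = trans (⟨⟩-cong Φ (λ xs → vanish (g (x ∷ x ∷ xs)) (value x) (∏- (value x) (map value xs)) _)) (⟨⟩-0 Φ)
        antisymmetric : ∀ x y → ⟨ Φ , (λ xs → F (x ∷ y ∷ xs)) ⟩ + ⟨ Φ , (λ xs → F (y ∷ x ∷ xs)) ⟩ ≡ + 0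
        antisymmetric x y = trans (sym (⟨⟩-+ Φ (λ xs → F (x ∷ y ∷ xs)) (λ xs → F (y ∷ x ∷ xs))))
          (trans (⟨⟩-cong Φ cancel) (⟨⟩-0 Φ))
          where
          cancel : ∀ xs → F (x ∷ y ∷ xs) + F (y ∷ x ∷ xs) ≡ + 0
          cancel xs rewrite g-↭ (↭.swap y x (↭.refl {xs = xs})) =
            opposite (g (x ∷ y ∷ xs)) (value x) (value y) (∏- (value x) (map value xs)) (∏- (value y) (map value xs)) _
      Block-repeating (there {n} {c} r) g g-↭ = begin
        ⟨ Block.functionals (n ∷ c) , (λ xs → g xs * vandermonde (map value xs)) ⟩
          ≡⟨ Block.functionals-∷ n c _ ⟩
        ⟨ difference 0 n , (λ x → ⟨ Block.functionals c , (λ xs → g (x ∷ xs) * (P x xs * V xs)) ⟩) ⟩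
          ≈⟨ ⟨⟩-≈0 (always inner (difference 0 n)) ⟩
        + 0 ∎
        where
        open SetoidReasoning ≈-setoid
        V : List X → ℤ
        V xs = vandermonde (map value xs)
        P : X → List X → ℤ
        P x xs = ∏- (value x) (map value xs)
        inner : ∀ x → ⟨ Block.functionals c , (λ xs → g (x ∷ xs) * (P x xs * V xs)) ⟩ ≈ + 0
        inner x = ≈-trans (≡⇒≈ (⟨⟩-cong (Block.functionals c) (λ xs → sym (ℤP.*-assoc (g (x ∷ xs)) (P x xs) (V xs)))))
          (Block-repeating r (λ xs → g (x ∷ xs) * P x xs) (λ e → cong₂ _*_ (g-↭ (↭.prep x e)) (∏-↭ value (value x) e)))

      -- A function of the total sum is symmetric inside every block, and this survives applying the
      -- functionals of the other blocks.
      Blocks-repeating : ∀ {cs} → Any Repeating cs → (g : ℤ → ℤ) →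
        ⟨ Blocks.functionals cs , (λ xss → g (Blocks.coordinates xss) * vandermondes value xss) ⟩ ≈ + 0
      Blocks-repeating {c ∷ cs} r g = ≈-trans (≡⇒≈ (Blocks.functionals-∷ c cs _)) (first r)
        where
        V : List X → ℤ
        V xs = vandermonde (map value xs)
        rest : List X → ℤ
        rest xs = ⟨ Blocks.functionals cs ,
            (λ xss → g (Block.coordinates xs + Blocks.coordinates xss) * vandermondes value xss) ⟩
        exchange : ∀ a b c → a * (b * c) ≡ b * (a * c)
        exchange = solve-∀
        inner : ∀ xs → ⟨ Blocks.functionals cs ,
            (λ xss → g (Block.coordinates xs + Blocks.coordinates xss) * (V xs * vandermondes value xss)) ⟩
          ≡ V xs * rest xs
        inner xs = trans (⟨⟩-cong (Blocks.functionals cs) (λ xss → exchange (g _) (V xs) (vandermondes value xss)))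
          (⟨⟩-* (Blocks.functionals cs) (V xs) _)
        first : Any Repeating (c ∷ cs) → ⟨ Block.functionals c , (λ xs → ⟨ Blocks.functionals cs ,
          (λ xss → g (Block.coordinates xs + Blocks.coordinates xss) * (V xs * vandermondes value xss)) ⟩) ⟩ ≈ + 0
        first (here r)  = ≈-trans (≡⇒≈ (⟨⟩-cong (Block.functionals c) (λ xs → trans (inner xs) (ℤP.*-comm (V xs) (rest xs)))))
          (Block-repeating r rest (λ e → ⟨⟩-cong (Blocks.functionals cs) (λ xss →
            cong (λ u → g (u + Blocks.coordinates xss) * vandermondes value xss) (coordinates-↭ e))))
        first (there r) = ⟨⟩-≈0 (always (λ xs → ≈-trans (≡⇒≈ (inner xs))
          (≈-trans (*-congˡ-≈ (V xs) (Blocks-repeating r (λ u → g (Block.coordinates xs + u))))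
              (≡⇒≈ (ℤP.*-zeroʳ (V xs))))) (Block.functionals c))

      record Lowering (c d : List ℕ) : Set where
        constructor lowering
        field
          same-length : length d ≡ length c
          sum-suc     : suc (sum d) ≡ sum c

      Block-lowers : ∀ {b c} → Descending b c → All (λ (w , d) → (Descending b d ⊎ Repeating d) × Lowering c d) (Block.lowers c)
      Block-lowers []                          = []
      Block-lowers (_∷_ {n = n} {c} n<b d) = AllP.++⁺ (AllP.map⁺ (first n n<b d))
          (AllP.map⁺ (All.map (λ {wd} → later {proj₂ wd}) (Block-lowers d)))
        where
        first : ∀ {b} n → n < b → Descending n c →
          All (λ (w , m) → (Descending b (m ∷ c) ⊎ Repeating (m ∷ c)) × Lowering (n ∷ c) (m ∷ c)) (lowerℕ n)
        first zero    n<b d = []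
        first (suc n) n<b d = (Sum.map₁ (ℕP.<-trans (ℕP.n<1+n n) n<b ∷_) (Descending-pred d) , lowering refl refl) ∷ []
        later : ∀ {d} → (Descending n d ⊎ Repeating d) × Lowering c d →
          (Descending _ (n ∷ d) ⊎ Repeating (n ∷ d)) × Lowering (n ∷ c) (n ∷ d)
        later (s , lowering l e) = Sum.map (n<b ∷_) there s , lowering (cong suc l) (trans (sym (ℕP.+-suc n _)) (cong (n ℕ.+_) e))

      record Lowerings (cs ds : List (List ℕ)) : Set where
        constructor lowerings
        field
          same-triangles : triangles ds ≡ triangles cs
          total-suc      : suc (total ds) ≡ total cs

      Blocks-lowers : ∀ {cs} → All (Descending k) cs →
        All (λ (w , ds) → (All (Descending k) ds ⊎ Any Repeating ds) × Lowerings cs ds) (Blocks.lowers cs)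
      Blocks-lowers []                        = []
      Blocks-lowers {c ∷ cs} (D ∷ Ds) = AllP.++⁺
          (AllP.map⁺ (All.map (λ {wd} → first {proj₂ wd}) (Block-lowers D)))
          (AllP.map⁺ (All.map (λ {wd} → later {proj₂ wd}) (Blocks-lowers Ds)))
        where
        first : ∀ {d} → (Descending k d ⊎ Repeating d) × Lowering c d →
          (All (Descending k) (d ∷ cs) ⊎ Any Repeating (d ∷ cs)) × Lowerings (c ∷ cs) (d ∷ cs)
        first (s , lowering l e) = Sum.map (_∷ Ds) here s ,
          lowerings (cong (λ u → triangle u ℕ.+ triangles cs) l) (cong (ℕ._+ total cs) e)
        later : ∀ {d} → (All (Descending k) d ⊎ Any Repeating d) × Lowerings cs d →
          (All (Descending k) (c ∷ d) ⊎ Any Repeating (c ∷ d)) × Lowerings (c ∷ cs) (c ∷ d)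
        later (s , lowerings t e) = Sum.map (D ∷_) there s ,
          lowerings (cong (triangle (length c) ℕ.+_) t) (trans (sym (ℕP.+-suc (sum c) _)) (cong (sum c ℕ.+_) e))

      Block-lowers-Σ : ∀ c F → ⟨ Block.lowers c , (λ d → F (map pos d)) ⟩ ≡ Σ-lower (λ e o l → e * F l) (map pos c)
      Block-lowers-Σ []      F = refl
      Block-lowers-Σ (n ∷ c) F = trans (⟨⟩-++ (push (_∷ c) (lowerℕ n)) (push (n ∷_) (Block.lowers c)) _)
        (cong₂ _+_ (trans (⟨⟩-push (_∷ c) (lowerℕ n) _) (first n))
                   (trans (⟨⟩-push (n ∷_) (Block.lowers c) _) (Block-lowers-Σ c (λ l → F (+ n ∷ l)))))
        where
        first : ∀ n → ⟨ lowerℕ n , (λ m → F (+ m ∷ map pos c)) ⟩ ≡ + n * F (+ n - + 1 ∷ map pos c)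
        -- An order 0 has no lowering in `lowerℕ`, while `Σ-lower` turns it into -1; the weight 0 of
        -- that term reconciles the two.
        first zero    = refl
        first (suc n) = ℤP.+-identityʳ _

      -- A lowering touches one block, so the Vandermonde products of the others factor out and the
      -- identity for single blocks adds up.
      Blocks-lowers-vandermondes : ∀ cs →
        ⟨ Blocks.lowers cs , vandermondes pos ⟩ ≡ (+ total cs - + triangles cs) * vandermondes pos cs
      Blocks-lowers-vandermondes []       = refl
      Blocks-lowers-vandermondes (c ∷ cs) = begin
        ⟨ Blocks.lowers (c ∷ cs) , vandermondes pos ⟩
          ≡⟨ ⟨⟩-++ (push (_∷ cs) (Block.lowers c)) (push (c ∷_) (Blocks.lowers cs)) _ ⟩
        ⟨ push (_∷ cs) (Block.lowers c) , vandermondes pos ⟩ + ⟨ push (c ∷_) (Blocks.lowers cs) , vandermondes pos ⟩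
          ≡⟨ cong₂ _+_ first later ⟩
        W * ((+ sum c - + triangle (length c)) * V) + V * ((+ total cs - + triangles cs) * W)
          ≡⟨ regroup V W (+ sum c) (+ triangle (length c)) (+ total cs) (+ triangles cs) ⟩
        (+ total (c ∷ cs) - + triangles (c ∷ cs)) * (V * W) ∎
        where
        open ≡-Reasoning
        V = vandermonde (map pos c)
        W = vandermondes pos cs
        regroup : ∀ v w s t s′ t′ → w * ((s - t) * v) + v * ((s′ - t′) * w) ≡ (s + s′ - (t + t′)) * (v * w)
        regroup = solve-∀
        first : ⟨ push (_∷ cs) (Block.lowers c) , vandermondes pos ⟩ ≡ W * ((+ sum c - + triangle (length c)) * V)
        first = begin
          ⟨ push (_∷ cs) (Block.lowers c) , vandermondes pos ⟩
            ≡⟨ ⟨⟩-push (_∷ cs) (Block.lowers c) _ ⟩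
          ⟨ Block.lowers c , (λ d → vandermonde (map pos d) * W) ⟩
            ≡⟨ ⟨⟩-cong (Block.lowers c) (λ d → ℤP.*-comm (vandermonde (map pos d)) W) ⟩
          ⟨ Block.lowers c , (λ d → W * vandermonde (map pos d)) ⟩
            ≡⟨ ⟨⟩-* (Block.lowers c) W _ ⟩
          W * ⟨ Block.lowers c , (λ d → vandermonde (map pos d)) ⟩
            ≡⟨ cong (W *_) (trans (Block-lowers-Σ c vandermonde) (Σ-weighted-vandermonde (map pos c))) ⟩
          W * ((sumℤ (map pos c) - + triangle (length (map pos c))) * V)
            ≡⟨ cong₂ (λ s l → W * ((s - + triangle l) * V)) (sumℤ-+ c) (length-map pos c) ⟩
          W * ((+ sum c - + triangle (length c)) * V) ∎
        later : ⟨ push (c ∷_) (Blocks.lowers cs) , vandermondes pos ⟩ ≡ V * ((+ total cs - + triangles cs) * W)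
        later = trans (⟨⟩-push (c ∷_) (Blocks.lowers cs) _)
          (trans (⟨⟩-* (Blocks.lowers cs) V _) (cong (V *_) (Blocks-lowers-vandermondes cs)))

      -- Values on Vandermonde products

      -- As a polynomial in its first point the Vandermonde product is monic of degree `length c`,
      -- up to a factor free of that point. Applying the first divided difference therefore gives a
      -- constant, whatever the other points are.
      Block-peel : ∀ n c K → (∀ ys → length ys ≡ length c → ⟨ difference 0 n , (λ x → ∏- (value x) ys) ⟩ ≈ K) →
        ⟨ Block.functionals (n ∷ c) , (λ xs → vandermonde (map value xs)) ⟩
          ≈ K * ⟨ Block.functionals c , (λ xs → vandermonde (map value xs)) ⟩
      Block-peel n c K top = begin
        ⟨ Block.functionals (n ∷ c) , V ⟩
          ≡⟨ Block.functionals-∷ n c V ⟩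
        ⟨ difference 0 n , (λ x → ⟨ Block.functionals c , (λ xs → P xs x * V xs) ⟩) ⟩
          ≡⟨ ⟨⟩-swap (difference 0 n) (Block.functionals c) (λ x xs → P xs x * V xs) ⟩
        ⟨ Block.functionals c , (λ xs → ⟨ difference 0 n , (λ x → P xs x * V xs) ⟩) ⟩
          ≡⟨ ⟨⟩-cong (Block.functionals c) (λ xs → trans (⟨⟩-cong (difference 0 n) (λ x → ℤP.*-comm (P xs x) (V xs)))
              (⟨⟩-* (difference 0 n) (V xs) (P xs))) ⟩
        ⟨ Block.functionals c , (λ xs → V xs * ⟨ difference 0 n , P xs ⟩) ⟩
          ≈⟨ ⟨⟩-cong-≈ (All.map (λ {wx} l → *-congˡ-≈ (V (proj₂ wx))
              (top (map value (proj₂ wx)) (trans (length-map value (proj₂ wx)) l)))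
              (Block-length c)) ⟩
        ⟨ Block.functionals c , (λ xs → V xs * K) ⟩
          ≡⟨ trans (⟨⟩-cong (Block.functionals c) (λ xs → ℤP.*-comm (V xs) K)) (⟨⟩-* (Block.functionals c) K V) ⟩
        K * ⟨ Block.functionals c , V ⟩ ∎
        where
        open SetoidReasoning ≈-setoid
        V : List X → ℤ
        V xs = vandermonde (map value xs)
        P : List X → X → ℤ
        P xs x = ∏- (value x) (map value xs)

      -- The leading order is at least the degree in its point. If it is larger the value is 0; if
      -- equal, the excess of the orders passes to the tail.
      Block-vandermonde-low : ∀ {b c} → Descending b c → b ≤ k → triangle (length c) < sum c →
        ⟨ Block.functionals c , (λ xs → vandermonde (map value xs)) ⟩ ≈ + 0
      Block-vandermonde-low {c = n ∷ c} (n<b ∷ d) b≤k t<s with ℕP.m≤n⇒m<n∨m≡n (Descending-length d)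
      ... | inj₁ l<n  = Block-peel n c (+ 0)
        (λ ys eq → difference-low-degree n ys (ℕP.<-≤-trans n<b b≤k) (subst (_< n) (sym eq) l<n))
      ... | inj₂ refl = ≈-trans
        (Block-peel n c (+ (n !)) (λ ys eq → difference-monic n ys (ℕP.<-≤-trans n<b b≤k) eq))
        (≈-trans (*-congˡ-≈ (+ (n !)) (Block-vandermonde-low d (ℕP.≤-trans (ℕP.<⇒≤ n<b) b≤k) (ℕP.+-cancelˡ-< n _ _ t<s)))
          (≡⇒≈ (ℤP.*-zeroʳ (+ (n !)))))

      -- Minimal sum forces the staircase, and the `n!` peeled off at each stage is the matching
      -- product of differences of orders.
      Block-vandermonde-top : ∀ {b c} → Descending b c → b ≤ k → sum c ≡ triangle (length c) →
        ⟨ Block.functionals c , (λ xs → vandermonde (map value xs)) ⟩ ≈ vandermonde (map pos c)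
      Block-vandermonde-top []                    b≤k s≡t = ≈-refl
      Block-vandermonde-top {c = n ∷ c} (n<b ∷ d) b≤k s≡t with ℕP.m≤n⇒m<n∨m≡n (Descending-length d)
      ... | inj₁ l<n  = contradiction (sym s≡t) (ℕP.<⇒≢ (ℕP.+-mono-<-≤ l<n (Descending-sum d)))
      ... | inj₂ refl = ≈-trans
        (Block-peel n c (+ (n !)) (λ ys eq → difference-monic n ys (ℕP.<-≤-trans n<b b≤k) eq))
        (*-cong-≈ (≡⇒≈ (trans (sym (∏-staircase 0 d refl)) (ℤP.*-identityʳ (∏- (+ n) (map pos c)))))
          (Block-vandermonde-top d (ℕP.≤-trans (ℕP.<⇒≤ n<b) b≤k) (ℕP.+-cancelˡ-≡ n _ _ s≡t)))

      Blocks-vandermondes-∷ : ∀ c cs → ⟨ Blocks.functionals (c ∷ cs) , vandermondes value ⟩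
        ≡ ⟨ Block.functionals c , (λ xs → vandermonde (map value xs)) ⟩ * ⟨ Blocks.functionals cs , vandermondes value ⟩
      Blocks-vandermondes-∷ c cs = trans (Blocks.functionals-∷ c cs (vandermondes value))
        (trans (⟨⟩-cong (Block.functionals c) (λ xs → trans (⟨⟩-* (Blocks.functionals cs) (V xs) (vandermondes value))
            (ℤP.*-comm (V xs) W)))
          (trans (⟨⟩-* (Block.functionals c) W V) (ℤP.*-comm W _)))
        where
        V : List X → ℤ
        V xs = vandermonde (map value xs)
        W = ⟨ Blocks.functionals cs , vandermondes value ⟩

      triangles≤total : ∀ {cs} → All (Descending k) cs → triangles cs ≤ total cs
      triangles≤total []       = z≤n
      triangles≤total (D ∷ Ds) = ℕP.+-mono-≤ (Descending-sum D) (triangles≤total Ds)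

      Blocks-vandermondes-low : ∀ {cs} → All (Descending k) cs → triangles cs < total cs →
          ⟨ Blocks.functionals cs , vandermondes value ⟩ ≈ + 0
      Blocks-vandermondes-low {c ∷ cs} (D ∷ Ds) t<s with ℕP.m≤n⇒m<n∨m≡n (Descending-sum D)
      ... | inj₁ t<s₁ = ≈-trans (≡⇒≈ (Blocks-vandermondes-∷ c cs)) (*-cong-≈ (Block-vandermonde-low D ℕP.≤-refl t<s₁) ≈-refl)
      ... | inj₂ t≡s₁ = ≈-trans (≡⇒≈ (Blocks-vandermondes-∷ c cs))
        (≈-trans (*-congˡ-≈ B (Blocks-vandermondes-low Ds
            (ℕP.+-cancelˡ-< (sum c) _ _ (subst (λ u → u ℕ.+ triangles cs < sum c ℕ.+ total cs) t≡s₁ t<s))))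
          (≡⇒≈ (ℤP.*-zeroʳ B)))
        where B = ⟨ Block.functionals c , (λ xs → vandermonde (map value xs)) ⟩

      Blocks-vandermondes-top : ∀ {cs} → All (Descending k) cs → total cs ≡ triangles cs →
        ⟨ Blocks.functionals cs , vandermondes value ⟩ ≈ vandermondes pos cs
      Blocks-vandermondes-top []                s≡t = ≈-refl
      Blocks-vandermondes-top {c ∷ cs} (D ∷ Ds) s≡t with ℕP.m≤n⇒m<n∨m≡n (Descending-sum D)
      ... | inj₁ t<s₁ = contradiction (sym s≡t) (ℕP.<⇒≢ (ℕP.+-mono-<-≤ t<s₁ (triangles≤total Ds)))
      ... | inj₂ t≡s₁ = ≈-trans (≡⇒≈ (Blocks-vandermondes-∷ c cs)) (*-cong-≈ (Block-vandermonde-top D ℕP.≤-refl (sym t≡s₁))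
        (Blocks-vandermondes-top Ds (ℕP.+-cancelˡ-≡ (sum c) _ _ (trans s≡t (cong (ℕ._+ triangles cs) t≡s₁)))))

      -- The polynomial that detects new sums

      -- Nonzero modulo a prime exactly where each block has entries of distinct values and the
      -- total avoids every `t`. Its degree is `length ts` plus the triangles of the block sizes.
      weight : List ℤ → List (List X) → ℤ
      weight ts xss = ∏- (Blocks.coordinates xss) ts * vandermondes value xss

      weight-∷ : ∀ t ts {cs} → All (Descending k) cs →
        ⟨ Blocks.functionals cs , weight (t ∷ ts) ⟩
          ≈ (Blocks.diagonals cs - t) * ⟨ Blocks.functionals cs , weight ts ⟩
              + ⟨ Blocks.lowers cs , (λ ds → ⟨ Blocks.functionals ds , weight ts ⟩) ⟩
      weight-∷ t ts {cs} Ds = ≈-trans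
        (≡⇒≈ (⟨⟩-cong (Blocks.functionals cs) (λ xss → ℤP.*-assoc (Blocks.coordinates xss - t)
            (∏- (Blocks.coordinates xss) ts) (vandermondes value xss))))
        (Blocks.product-rules (All.map (Ok ℕP.≤-refl) Ds) (- t) (weight ts))
        where
        Ok : ∀ {b c} → b ≤ k → Descending b c → All (_< k) c
        Ok b≤k []        = []
        Ok b≤k (n<b ∷ d) = ℕP.<-≤-trans n<b b≤k ∷ Ok (ℕP.≤-trans (ℕP.<⇒≤ n<b) b≤k) d

      weight-repeating : ∀ ts {ds} → Any Repeating ds → ⟨ Blocks.functionals ds , weight ts ⟩ ≈ + 0
      weight-repeating ts r = Blocks-repeating r (λ u → ∏- u ts)

      -- Degree below total order. Removing a factor keeps the order in the diagonal term and lowers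
      -- it by one in the others, so the inequality persists.
      weight-low : ∀ ts {cs} → All (Descending k) cs → length ts ℕ.+ triangles cs < total cs →
        ⟨ Blocks.functionals cs , weight ts ⟩ ≈ + 0
      weight-low []       {cs} Ds <s = ≈-trans
        (≡⇒≈ (⟨⟩-cong (Blocks.functionals cs) (λ xss → ℤP.*-identityˡ (vandermondes value xss)))) (Blocks-vandermondes-low Ds <s)
      weight-low (t ∷ ts) {cs} Ds <s = ≈-trans (weight-∷ t ts Ds) (≈-trans
        (+-cong-≈ (*-congˡ-≈ (Blocks.diagonals cs - t) (weight-low ts Ds (ℕP.<-trans (ℕP.n<1+n _) <s)))
          (⟨⟩-≈0 (All.map (λ {wd} → lowered {proj₂ wd}) (Blocks-lowers Ds))))
        (≡⇒≈ (zeros (Blocks.diagonals cs - t))))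
        where
        zeros : ∀ a → a * + 0 + + 0 ≡ + 0
        zeros = solve-∀
        lowered : ∀ {d} → (All (Descending k) d ⊎ Any Repeating d) × Lowerings cs d →
          ⟨ Blocks.functionals d , weight ts ⟩ ≈ + 0
        lowered (inj₁ Ds′ , lowerings t≡ s≡) = weight-low ts Ds′
          (ℕ.s<s⁻¹ (subst₂ (λ u w → suc (length ts ℕ.+ u) < w) (sym t≡) (sym s≡) <s))
        lowered (inj₂ r , _)                 = weight-repeating ts r

      -- With one factor removed, the diagonal term falls under `weight-low`. The lowered orders are
      -- again at top degree, and summing their Vandermonde products gives the factor
      -- `total - triangles = suc l`. Repeating orders fit in since both sides are 0 there.
      weight-top : ∀ ts {cs} → All (Descending k) cs → total cs ≡ length ts ℕ.+ triangles cs →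
        ⟨ Blocks.functionals cs , weight ts ⟩ ≈ + (length ts !) * vandermondes pos cs
      weight-top []       {cs} Ds s≡ = ≈-trans
        (≡⇒≈ (⟨⟩-cong (Blocks.functionals cs) (λ xss → ℤP.*-identityˡ (vandermondes value xss))))
        (≈-trans (Blocks-vandermondes-top Ds s≡) (≡⇒≈ (sym (ℤP.*-identityˡ _))))
      weight-top (t ∷ ts) {cs} Ds s≡ = begin
        ⟨ Blocks.functionals cs , weight (t ∷ ts) ⟩
          ≈⟨ weight-∷ t ts Ds ⟩
        (Blocks.diagonals cs - t) * ⟨ Blocks.functionals cs , weight ts ⟩
            + ⟨ Blocks.lowers cs , (λ ds → ⟨ Blocks.functionals ds , weight ts ⟩) ⟩
          ≈⟨ +-cong-≈ (*-congˡ-≈ (Blocks.diagonals cs - t) (weight-low ts Ds (ℕP.≤-reflexive (sym s≡))))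
               (⟨⟩-cong-≈ (All.map (λ {wd} → lowered {proj₂ wd}) (Blocks-lowers Ds))) ⟩
        (Blocks.diagonals cs - t) * + 0 + ⟨ Blocks.lowers cs , (λ ds → + (l !) * vandermondes pos ds) ⟩
          ≡⟨ cong (λ u → (Blocks.diagonals cs - t) * + 0 + u)
              (trans (⟨⟩-* (Blocks.lowers cs) (+ (l !)) (vandermondes pos))
               (cong (+ (l !) *_) (Blocks-lowers-vandermondes cs))) ⟩
        (Blocks.diagonals cs - t) * + 0 + + (l !) * ((+ total cs - + triangles cs) * W)
          ≡⟨ cong (λ u → (Blocks.diagonals cs - t) * + 0 + + (l !) * ((+ u - + triangles cs) * W)) s≡ ⟩
        (Blocks.diagonals cs - t) * + 0 + + (l !) * ((+ suc l + + triangles cs - + triangles cs) * W)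
          ≡⟨ regroup (Blocks.diagonals cs - t) (+ (l !)) (+ suc l) (+ triangles cs) W ⟩
        + suc l * + (l !) * W
          ≡⟨ cong (_* W) (sym (ℤP.pos-* (suc l) (l !))) ⟩
        + (suc l !) * W ∎
        where
        open SetoidReasoning ≈-setoid
        l = length ts
        W = vandermondes pos cs
        regroup : ∀ d f l t w → d * + 0 + f * ((l + t - t) * w) ≡ l * f * w
        regroup = solve-∀
        lowered : ∀ {d} → (All (Descending k) d ⊎ Any Repeating d) × Lowerings cs d →
          ⟨ Blocks.functionals d , weight ts ⟩ ≈ + (l !) * vandermondes pos d
        lowered (inj₁ Ds′ , lowerings t≡ e) = weight-top ts Ds′
          (ℕP.suc-injective (trans e (trans s≡ (cong (λ u → suc (l ℕ.+ u)) (sym t≡)))))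
        lowered (inj₂ r , _)                = ≈-trans (weight-repeating ts r)
          (≡⇒≈ (sym (trans (cong (+ (l !) *_) (vandermondes-repeating r)) (ℤP.*-zeroʳ (+ (l !))))))

      -- Any orders with the right total serve, because the value at top degree is a factorial below
      -- `p !` times differences of distinct numbers below `p`.
      nonvanishing-point : k ≤ p → ∀ hs ts → All (_≤ k) hs → length ts ≤ capacity k hs → length ts < p →
        ∃[ xss ] (map length xss ≡ hs × weight ts xss ≉ + 0)
      nonvanishing-point k≤p hs ts hs≤k len≤ len<p =
        let cs , descs , lens , total≡ = fills k hs (length ts) hs≤k len≤
            Φ≉0 = λ Φ≈0 → *-≉0 (!-≉0 len<p) (vandermondes-≉0 k≤p descs) (≈-trans (≈-sym (weight-top ts descs total≡)) Φ≈0)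
            xss , len , W≉0 = ⟨⟩-≉0 (Blocks-length cs) Φ≉0
        in xss , trans len lens , W≉0

  -- Multiplicities of elements in a family of blocks

  δ : ∀ {k} → Fin k → Fin k → ℕ
  δ zero    zero    = 1
  δ zero    (suc j) = 0
  δ (suc i) zero    = 0
  δ (suc i) (suc j) = δ i j

  δ-cases : ∀ {k} (i j : Fin k) → δ i j ≡ 0 ⊎ (i ≡ j × δ i j ≡ 1)
  δ-cases zero    zero    = inj₂ (refl , refl)
  δ-cases zero    (suc j) = inj₁ refl
  δ-cases (suc i) zero    = inj₁ refl
  δ-cases (suc i) (suc j) = Sum.map₂ (λ (i≡j , δ≡1) → cong suc i≡j , δ≡1) (δ-cases i j)

  ΣFin-cong : ∀ {k} {f g : Fin k → ℕ} → (∀ i → f i ≡ g i) → ΣFin f ≡ ΣFin g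
  ΣFin-cong {zero}  eq = refl
  ΣFin-cong {suc k} eq = cong₂ ℕ._+_ (eq zero) (ΣFin-cong (eq ∘ suc))

  ΣFin-0 : ∀ k → ΣFin {k} (λ _ → 0) ≡ 0
  ΣFin-0 zero    = refl
  ΣFin-0 (suc k) = ΣFin-0 k

  ΣFin-+ : ∀ {k} (f g : Fin k → ℕ) → ΣFin (λ i → f i ℕ.+ g i) ≡ ΣFin f ℕ.+ ΣFin g
  ΣFin-+ {zero}  f g = refl
  ΣFin-+ {suc k} f g = trans (cong (f zero ℕ.+ g zero ℕ.+_) (ΣFin-+ (f ∘ suc) (g ∘ suc))) (regroup (f zero) (g zero) _ _)
    where
    regroup : ∀ a b c d → a ℕ.+ b ℕ.+ (c ℕ.+ d) ≡ a ℕ.+ c ℕ.+ (b ℕ.+ d)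
    regroup = ℕSolver.solve-∀

  ΣFin-δ : ∀ {k} (j : Fin k) (g : Fin k → ℕ) → ΣFin (λ i → δ i j ℕ.* g i) ≡ g j
  ΣFin-δ {suc k} zero    g = trans (cong₂ ℕ._+_ (ℕP.*-identityˡ (g zero)) (ΣFin-0 k)) (ℕP.+-identityʳ (g zero))
  ΣFin-δ {suc k} (suc j) g = ΣFin-δ j (g ∘ suc)

  occurrences : ∀ {k} → Fin k → List (Fin k) → ℕ
  occurrences i []       = 0
  occurrences i (x ∷ xs) = δ i x ℕ.+ occurrences i xs

  multiplicity : ∀ {k} → List (List (Fin k)) → Fin k → ℕ
  multiplicity []         i = 0
  multiplicity (xs ∷ xss) i = occurrences i xs ℕ.+ multiplicity xss i

  ΣFin-occurrences : ∀ {k} (g : Fin k → ℕ) xs → ΣFin (λ i → occurrences i xs ℕ.* g i) ≡ sum (map g xs)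
  ΣFin-occurrences {k} g []       = ΣFin-0 k
  ΣFin-occurrences g (x ∷ xs) = begin
    ΣFin (λ i → (δ i x ℕ.+ occurrences i xs) ℕ.* g i)
      ≡⟨ ΣFin-cong (λ i → ℕP.*-distribʳ-+ (g i) (δ i x) (occurrences i xs)) ⟩
    ΣFin (λ i → δ i x ℕ.* g i ℕ.+ occurrences i xs ℕ.* g i)
      ≡⟨ ΣFin-+ (λ i → δ i x ℕ.* g i) (λ i → occurrences i xs ℕ.* g i) ⟩
    ΣFin (λ i → δ i x ℕ.* g i) ℕ.+ ΣFin (λ i → occurrences i xs ℕ.* g i)
      ≡⟨ cong₂ ℕ._+_ (ΣFin-δ x g) (ΣFin-occurrences g xs) ⟩
    g x ℕ.+ sum (map g xs) ∎
    where open ≡-Reasoning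

  ΣFin-multiplicity : ∀ {k} (g : Fin k → ℕ) xss →
      ΣFin (λ i → multiplicity xss i ℕ.* g i) ≡ sum (map (λ xs → sum (map g xs)) xss)
  ΣFin-multiplicity {k} g []         = ΣFin-0 k
  ΣFin-multiplicity g (xs ∷ xss) = begin
    ΣFin (λ i → (occurrences i xs ℕ.+ multiplicity xss i) ℕ.* g i)
      ≡⟨ ΣFin-cong (λ i → ℕP.*-distribʳ-+ (g i) (occurrences i xs) (multiplicity xss i)) ⟩
    ΣFin (λ i → occurrences i xs ℕ.* g i ℕ.+ multiplicity xss i ℕ.* g i)
      ≡⟨ ΣFin-+ (λ i → occurrences i xs ℕ.* g i) (λ i → multiplicity xss i ℕ.* g i) ⟩
    ΣFin (λ i → occurrences i xs ℕ.* g i) ℕ.+ ΣFin (λ i → multiplicity xss i ℕ.* g i)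
      ≡⟨ cong₂ ℕ._+_ (ΣFin-occurrences g xs) (ΣFin-multiplicity g xss) ⟩
    sum (map g xs) ℕ.+ sum (map (λ xs → sum (map g xs)) xss) ∎
    where open ≡-Reasoning

  sum-map-1 : ∀ {A : Set} (xs : List A) → sum (map (λ _ → 1) xs) ≡ length xs
  sum-map-1 []       = refl
  sum-map-1 (x ∷ xs) = cong suc (sum-map-1 xs)

  ΣFin-multiplicity-1 : ∀ {k} (xss : List (List (Fin k))) → ΣFin (multiplicity xss) ≡ sum (map length xss)
  ΣFin-multiplicity-1 xss = trans (ΣFin-cong (λ i → sym (ℕP.*-identityʳ (multiplicity xss i))))
    (trans (ΣFin-multiplicity (λ _ → 1) xss) (lengths xss))
    where
    lengths : ∀ xss → sum (map (λ xs → sum (map (λ _ → 1) xs)) xss) ≡ sum (map length xss)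
    lengths []         = refl
    lengths (xs ∷ xss) = cong₂ ℕ._+_ (sum-map-1 xs) (lengths xss)

  -- Enlarging the set of known sums

  module Sumset (p : ℕ) (pp : Prime p) (k : ℕ) (a : Fin (suc k) → Fin p) (a-injective : Injective _≡_ _≡_ a) where
    open Congruence p
    open PrimeField p pp

    value : Fin (suc k) → ℤ
    value i = + toℕ (a i)

    -- The reduction only makes the enumeration total; below `suc k` it changes nothing.
    node : ℕ → Fin (suc k)
    node j = j mod suc k

    toℕ-node : ∀ {j} → j < suc k → toℕ (node j) ≡ j
    toℕ-node j<k = trans (FinP.toℕ-fromℕ< _) (m<n⇒m%n≡m j<k)

    distinct : ∀ {i j} → i < j → j < suc k → value (node j) - value (node i) ≉ + 0
    distinct {i} {j} i<j j<k eq = ℕP.<⇒≢ i<j (begin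
      i             ≡⟨ toℕ-node (ℕP.<-trans i<j j<k) ⟨
      toℕ (node i)  ≡⟨ cong toℕ (a-injective (residues-distinct eq)) ⟨
      toℕ (node j)  ≡⟨ toℕ-node j<k ⟩
      j             ∎)
      where open ≡-Reasoning

    open DividedDifference value node (suc k) distinct

    occurrences-0 : ∀ x xs → ∏- (value x) (map value xs) ≉ + 0 → occurrences x xs ≡ 0
    occurrences-0 x []       _    = refl
    occurrences-0 x (y ∷ ys) P≉0 with δ-cases x y
    ... | inj₁ δ≡0       = cong₂ ℕ._+_ δ≡0 (occurrences-0 x ys (*-≉0ʳ {value x - value y} P≉0))
    ... | inj₂ (refl , _) = contradiction (≡⇒≈ (ℤP.+-inverseʳ (value x))) (*-≉0ˡ P≉0)

    -- A repeated entry would put a zero factor into the Vandermonde product.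
    occurrences≤1 : ∀ i xs → vandermonde (map value xs) ≉ + 0 → occurrences i xs ≤ 1
    occurrences≤1 i []       _   = z≤n
    occurrences≤1 i (x ∷ xs) V≉0 with δ-cases i x
    ... | inj₁ δ≡0 rewrite δ≡0 = occurrences≤1 i xs (*-≉0ʳ {∏- (value x) (map value xs)} V≉0)
    ... | inj₂ (refl , δ≡1)    = ℕP.≤-reflexive (cong₂ ℕ._+_ δ≡1 (occurrences-0 x xs (*-≉0ˡ V≉0)))

    -- The source of the bound `r` on multiplicities: there are `r` blocks, and each uses an element
    -- at most once.
    multiplicity≤ : ∀ i xss → vandermondes value xss ≉ + 0 → multiplicity xss i ≤ length xss
    multiplicity≤ i []         _   = z≤n
    multiplicity≤ i (xs ∷ xss) W≉0 =
      ℕP.+-mono-≤ (occurrences≤1 i xs (*-≉0ˡ W≉0)) (multiplicity≤ i xss (*-≉0ʳ {vandermonde (map value xs)} W≉0))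

    Block-coordinates : ∀ xs → Block.coordinates xs ≡ + sum (map (toℕ ∘ a) xs)
    Block-coordinates []       = refl
    Block-coordinates (x ∷ xs) = cong (λ u → value x + u) (Block-coordinates xs)

    Blocks-coordinates : ∀ xss → Blocks.coordinates xss ≡ + sum (map (λ xs → sum (map (toℕ ∘ a) xs)) xss)
    Blocks-coordinates []         = refl
    Blocks-coordinates (xs ∷ xss) = cong₂ _+_ (Block-coordinates xs) (Blocks-coordinates xss)

    residue : ℕ → Fin p
    residue n = fromℕ< (m%n<n n p {{prime⇒nonZero pp}})

    residue-≈ : ∀ n → + n ≈ + toℕ (residue n)
    residue-≈ n = mod-p (divides (+ q) (begin
      + n - + toℕ (residue n)              ≡⟨ cong₂ (λ u v → + u - + v) (m≡m%n+[m/n]*n n p) (FinP.toℕ-fromℕ< (m%n<n n p)) ⟩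
      + (n % p ℕ.+ q ℕ.* p) - + (n % p)    ≡⟨ cancel (+ (n % p)) (+ (q ℕ.* p)) ⟩
      + (q ℕ.* p)                          ≡⟨ ℤP.pos-* q p ⟩
      + q * + p                            ∎))
      where
      open ≡-Reasoning
      instance _ = prime⇒nonZero pp
      q = n / p
      cancel : ∀ a b → a + b - a ≡ b
      cancel = solve-∀

    -- The `n` sums found so far serve as the roots `t`. Finding one more needs `n < p` for the
    -- factorial and `n ≤ capacity` for the orders, hence the `suc` in the bound.
    sumset-size : ∀ hs → All (_≤ suc k) hs → ∀ n → n ≤ p → n ≤ suc (capacity (suc k) hs) →
      HasAtLeast p (InSumset p pp (suc k) a (sum hs) (length hs)) n
    sumset-size hs hs≤k zero    _   _         = (λ ()) , (λ {}) , (λ ())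
    sumset-size hs hs≤k (suc n) n<p (s≤s n≤) = extend (sumset-size hs hs≤k n (ℕP.<⇒≤ n<p) (ℕP.m≤n⇒m≤1+n n≤))
      where
      extend : HasAtLeast p (InSumset p pp (suc k) a (sum hs) (length hs)) n →
               HasAtLeast p (InSumset p pp (suc k) a (sum hs) (length hs)) (suc n)
      extend (f , f-injective , f∈) = g , (λ {i} {j} → g-injective i j) , g∈
        where
        ts : List ℤ
        ts = tabulate (λ i → + toℕ (f i))
        length-ts : length ts ≡ n
        length-ts = length-tabulate (λ i → + toℕ (f i))
        -- Injectivity of `a` yields `suc k ≤ p`, which keeps distinct orders incongruent.
        point = nonvanishing-point (FinP.injective⇒≤ a-injective) hs ts hs≤k
          (subst (_≤ _) (sym length-ts) n≤) (subst (_< p) (sym length-ts) n<p)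
        xss = proj₁ point
        lengths = proj₁ (proj₂ point)
        weight≉0 = proj₂ (proj₂ point)
        N = ΣFin (λ i → multiplicity xss i ℕ.* toℕ (a i))
        new : Fin p
        new = residue N
        coordinates≈new : Blocks.coordinates xss ≈ + toℕ new
        coordinates≈new = ≈-trans
            (≡⇒≈ (trans (Blocks-coordinates xss) (cong +_ (sym (ΣFin-multiplicity (toℕ ∘ a) xss))))) (residue-≈ N)
        new∉ : ∀ i → new ≢ f i
        new∉ i eq = *-≉0ˡ weight≉0 (∏-∈ (Blocks.coordinates xss) (∈-tabulate⁺ i)
          (subst (λ x → Blocks.coordinates xss ≈ + toℕ x) eq coordinates≈new))
        length-xss : length xss ≡ length hs
        length-xss = trans (sym (length-map length xss)) (cong length lengths)
        g : Fin (suc n) → Fin p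
        g zero    = new
        g (suc i) = f i
        g-injective : ∀ i j → g i ≡ g j → i ≡ j
        g-injective zero    zero    eq = refl
        g-injective zero    (suc j) eq = contradiction eq (new∉ j)
        g-injective (suc i) zero    eq = contradiction (sym eq) (new∉ i)
        g-injective (suc i) (suc j) eq = cong suc (f-injective eq)
        g∈ : ∀ i → InSumset p pp (suc k) a (sum hs) (length hs) (g i)
        g∈ zero    = multiplicity xss ,
          (λ i → subst (multiplicity xss i ≤_) length-xss
              (multiplicity≤ i xss (*-≉0ʳ {∏- (Blocks.coordinates xss) ts} weight≉0))) ,
          trans (ΣFin-multiplicity-1 xss) (cong sum lengths) ,
          FinP.toℕ-fromℕ< _
        g∈ (suc i) = f∈ i

  -- Block sizes and the numerical bound

  blockSizes : ℕ → ℕ → ℕ → List ℕ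
  blockSizes m r ε = replicate ε (suc m) ++ replicate (r ∸ ε) m

  length-blockSizes : ∀ m r ε → ε ≤ r → length (blockSizes m r ε) ≡ r
  length-blockSizes m r ε ε≤r = begin
    length (blockSizes m r ε)                                     ≡⟨ length-++ (replicate ε (suc m)) ⟩
    length (replicate ε (suc m)) ℕ.+ length (replicate (r ∸ ε) m) ≡⟨ cong₂ ℕ._+_ (length-replicate ε) (length-replicate (r ∸ ε)) ⟩
    ε ℕ.+ (r ∸ ε)                                                 ≡⟨ ℕP.m+[n∸m]≡n ε≤r ⟩
    r                                                             ∎
    where open ≡-Reasoning

  sum-map-++ : ∀ {A : Set} (f : A → ℕ) xs ys → sum (map f (xs ++ ys)) ≡ sum (map f xs) ℕ.+ sum (map f ys)
  sum-map-++ f xs ys = trans (cong sum (map-++ f xs ys)) (sum-++ (map f xs) (map f ys))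

  sum-map-replicate : ∀ {A : Set} (f : A → ℕ) n x → sum (map f (replicate n x)) ≡ n ℕ.* f x
  sum-map-replicate f zero    x = refl
  sum-map-replicate f (suc n) x = cong (f x ℕ.+_) (sum-map-replicate f n x)

  sum-map-blockSizes : ∀ f m r ε → sum (map f (blockSizes m r ε)) ≡ ε ℕ.* f (suc m) ℕ.+ (r ∸ ε) ℕ.* f m
  sum-map-blockSizes f m r ε = trans (sum-map-++ f (replicate ε (suc m)) (replicate (r ∸ ε) m))
    (cong₂ ℕ._+_ (sum-map-replicate f ε (suc m)) (sum-map-replicate f (r ∸ ε) m))

  sum-blockSizes : ∀ m r ε → ε ≤ r → sum (blockSizes m r ε) ≡ m ℕ.* r ℕ.+ ε
  sum-blockSizes m r ε ε≤r = begin
    sum (blockSizes m r ε)           ≡⟨ cong sum (map-id (blockSizes m r ε)) ⟨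
    sum (map id (blockSizes m r ε))  ≡⟨ sum-map-blockSizes id m r ε ⟩
    ε ℕ.* suc m ℕ.+ (r ∸ ε) ℕ.* m    ≡⟨ regroup ε m (r ∸ ε) ⟩
    m ℕ.* (ε ℕ.+ (r ∸ ε)) ℕ.+ ε      ≡⟨ cong (λ u → m ℕ.* u ℕ.+ ε) (ℕP.m+[n∸m]≡n ε≤r) ⟩
    m ℕ.* r ℕ.+ ε                    ∎
    where
    open ≡-Reasoning
    regroup : ∀ e m d → e ℕ.* suc m ℕ.+ d ℕ.* m ≡ m ℕ.* (e ℕ.+ d) ℕ.+ e
    regroup = ℕSolver.solve-∀

  -- `m * r ≤ k * r` gives `m ≤ k`. Blocks of size `suc m` occur only for positive `ε`, and then the
  -- inequality is strict.
  blockSizes≤ : ∀ m r ε k → m ℕ.* r ℕ.+ ε ≤ r ℕ.* k → ε < r → All (_≤ k) (blockSizes m r ε)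
  blockSizes≤ m (suc r) ε k h≤rk ε<r = AllP.++⁺ (large ε mr+ε≤kr) (AllP.replicate⁺ (suc r ∸ ε) m≤k)
    where
    mr+ε≤kr : m ℕ.* suc r ℕ.+ ε ≤ k ℕ.* suc r
    mr+ε≤kr = ℕP.≤-trans h≤rk (ℕP.≤-reflexive (ℕP.*-comm (suc r) k))
    m≤k : m ≤ k
    m≤k = ℕP.*-cancelʳ-≤ m k (suc r) (ℕP.≤-trans (ℕP.m≤m+n (m ℕ.* suc r) ε) mr+ε≤kr)
    large : ∀ ε → m ℕ.* suc r ℕ.+ ε ≤ k ℕ.* suc r → All (_≤ k) (replicate ε (suc m))
    large zero    _  = []
    large (suc ε) le = AllP.replicate⁺ (suc ε) (ℕP.*-cancelʳ-< (suc r) m k (ℕP.<-≤-trans (ℕP.m<m+n (m ℕ.* suc r) (s≤s z≤n)) le))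

  -- Summing `h (k - h) + h² = h k` in additive form avoids truncated subtraction.
  capacity-squares : ∀ k {hs} → All (_≤ k) hs → sum hs ℕ.* k ≡ capacity k hs ℕ.+ sum (map (λ h → h ℕ.* h) hs)
  capacity-squares k []                      = refl
  capacity-squares k {h ∷ hs} (h≤k ∷ hs≤k) = begin
    (h ℕ.+ sum hs) ℕ.* k                             ≡⟨ ℕP.*-distribʳ-+ k h (sum hs) ⟩
    h ℕ.* k ℕ.+ sum hs ℕ.* k                         ≡⟨ cong₂ (λ u v → h ℕ.* u ℕ.+ v)
        (sym (ℕP.m∸n+n≡m h≤k)) (capacity-squares k hs≤k) ⟩
    h ℕ.* (k ∸ h ℕ.+ h) ℕ.+ (capacity k hs ℕ.+ squares) ≡⟨ regroup h (k ∸ h) (capacity k hs) squares ⟩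
    h ℕ.* (k ∸ h) ℕ.+ capacity k hs ℕ.+ (h ℕ.* h ℕ.+ squares) ∎
    where
    open ≡-Reasoning
    squares = sum (map (λ h → h ℕ.* h) hs)
    regroup : ∀ h d c s → h ℕ.* (d ℕ.+ h) ℕ.+ (c ℕ.+ s) ≡ h ℕ.* d ℕ.+ c ℕ.+ (h ℕ.* h ℕ.+ s)
    regroup = ℕSolver.solve-∀

  capacity-blockSizes : ∀ m r ε k → ε ≤ r → All (_≤ k) (blockSizes m r ε) →
    (m ℕ.* r ℕ.+ ε) ℕ.* k ≡ capacity k (blockSizes m r ε) ℕ.+ (m ℕ.* m ℕ.* r ℕ.+ (2 ℕ.* m ℕ.* ε ℕ.+ ε))
  capacity-blockSizes m r ε k ε≤r sizes≤k = begin
    (m ℕ.* r ℕ.+ ε) ℕ.* k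
      ≡⟨ cong (ℕ._* k) (sum-blockSizes m r ε ε≤r) ⟨
    sum hs ℕ.* k
      ≡⟨ capacity-squares k sizes≤k ⟩
    capacity k hs ℕ.+ sum (map (λ h → h ℕ.* h) hs)
      ≡⟨ cong (capacity k hs ℕ.+_) (sum-map-blockSizes (λ h → h ℕ.* h) m r ε) ⟩
    capacity k hs ℕ.+ (ε ℕ.* (suc m ℕ.* suc m) ℕ.+ (r ∸ ε) ℕ.* (m ℕ.* m))
      -- The three subtracted terms of the bound are the sum of squares of the block sizes,
      -- `ε (m + 1)² + (r - ε) m²`.
      ≡⟨ cong (capacity k hs ℕ.+_) (regroup ε m (r ∸ ε)) ⟩
    capacity k hs ℕ.+ (m ℕ.* m ℕ.* (ε ℕ.+ (r ∸ ε)) ℕ.+ (2 ℕ.* m ℕ.* ε ℕ.+ ε))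
      ≡⟨ cong (λ u → capacity k hs ℕ.+ (m ℕ.* m ℕ.* u ℕ.+ (2 ℕ.* m ℕ.* ε ℕ.+ ε))) (ℕP.m+[n∸m]≡n ε≤r) ⟩
    capacity k hs ℕ.+ (m ℕ.* m ℕ.* r ℕ.+ (2 ℕ.* m ℕ.* ε ℕ.+ ε)) ∎
    where
    open ≡-Reasoning
    hs = blockSizes m r ε
    regroup : ∀ e m d → e ℕ.* (suc m ℕ.* suc m) ℕ.+ d ℕ.* (m ℕ.* m) ≡ m ℕ.* m ℕ.* (e ℕ.+ d) ℕ.+ (2 ℕ.* m ℕ.* e ℕ.+ e)
    regroup = ℕSolver.solve-∀

  bound-blockSizes : ∀ m r ε k → ε ≤ r → All (_≤ k) (blockSizes m r ε) →
    + ((m ℕ.* r ℕ.+ ε) ℕ.* k) - + (m ℕ.* m ℕ.* r) + + 1 - + (2 ℕ.* m ℕ.* ε) - + ε ≡ + suc (capacity k (blockSizes m r ε))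
  bound-blockSizes m r ε k ε≤r sizes≤k = trans
    (cong (λ u → + u - + (m ℕ.* m ℕ.* r) + + 1 - + (2 ℕ.* m ℕ.* ε) - + ε) (capacity-blockSizes m r ε k ε≤r sizes≤k))
    (cancel (+ capacity k (blockSizes m r ε)) (+ (m ℕ.* m ℕ.* r)) (+ (2 ℕ.* m ℕ.* ε)) (+ ε))
    where
    cancel : ∀ c s d e → c + (s + (d + e)) - s + + 1 - d - e ≡ + 1 + c
    cancel = solve-∀

open import Data.Nat using (ℕ; _*_; _≤_; _<_; _+_)
open import Data.Nat.Primality using (Prime)
open import Data.Integer using (ℤ; +_; _-_; _⊓_)
open import Data.Integer as ℤ using ()
open import Data.Fin using (Fin)
open import Data.Product using (∃-syntax; _×_; _,_)
open import Function.Definitions using (Injective)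
open import Relation.Binary.PropositionalEquality using (_≡_; refl; cong; subst₂)
open PolynomialMethod

theorem2 : (p : ℕ) (pp : Prime p) (h r m ε k : ℕ) (a : Fin k → Fin p) →
    Injective _≡_ _≡_ a → 1 ≤ k →
    h ≡ m * r + ε → ε < r →
    1 ≤ r → r ≤ h → h ≤ r * k →
    ∃[ n ] (HasAtLeast p (InSumset p pp k a h r) n ×
    ((+ p) ⊓ ((((+ (h * k) - + (m * m * r)) ℤ.+ + 1) - + (2 * m * ε)) - + ε)) ℤ.≤ + n)
theorem2 p pp _ r m ε (ℕ.suc k) a a-injective (ℕ.s≤s _) refl ε<r _ _ h≤rk =
  n ,
  subst₂ (λ h r → HasAtLeast p (InSumset p pp (ℕ.suc k) a h r) n)
    (sum-blockSizes m r ε ε≤r) (length-blockSizes m r ε ε≤r)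
    (sumset-size hs hs≤k n (ℕP.m⊓n≤m p (ℕ.suc N)) (ℕP.m⊓n≤n p (ℕ.suc N))) ,
  -- The integer expression equals `suc N` exactly, so its minimum with `p` is `n` itself.
  ℤP.≤-reflexive (cong (+ p ⊓_) (bound-blockSizes m r ε (ℕ.suc k) ε≤r hs≤k))
  where
  open Sumset p pp k a a-injective using (sumset-size)
  hs = blockSizes m r ε
  N = capacity (ℕ.suc k) hs
  n = p ℕ.⊓ ℕ.suc N
  ε≤r = ℕP.<⇒≤ ε<r
  hs≤k = blockSizes≤ m r ε (ℕ.suc k) h≤rk ε<r
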